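{- Let $r\ge 1$. For all integers $\ell_1,\dots,\ell_r,k,n\ge 0$, $$\overline{D}(\ell_1,\dots,\ell_r;k,n)=\overline{E}(\ell_1,\dots,\ell_r;k,n),$$ where: $\overline{D}(\ell_1,\dots,\ell_r;k,n)$ is the number of overpartitions of $n$ into non-negative parts, each part coloured with one of the primary colours $u_1,\dots,u_r$, having exactly $\ell_i$ parts coloured $u_i$ for every $i\in\{1,\dots,r\}$ and exactly $k$ non-overlined parts; and $\overline{E}(\ell_1,\dots,\ell_r;k,n)$ is the number of finite sequences $\lambda_1\ge\lambda_2\ge\dots\ge\lambda_s$ of non-negative integers with $\lambda_1+\dots+\lambda_s=n$, each part $\lambda_t$ carrying a colour $c(\lambda_t)\in\{\tilde u_1,\dots,\tilde u_{2^r-1}\}$ and being either overlined or not, such that for each $i\in\{1,\dots,r\}$ exactly $\ell_i$ parts have $u_i$ as one of their primary colours, exactly $k$ parts are non-overlined, and for all $1\le t<s$ $$\lambda_t-\lambda_{t+1}\ \ge\ w(c(\lambda_{t+1}))+\chi(\overline{\lambda_{t+1}})-1+\delta(c(\lambda_t),c(\lambda_{t+1})),$$ where $\chi(\overline{\lambda_{t+1}})=1$ if $\lambda_{t+1}$ is overlined and $0$ otherwise.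
   Context: Primary colours $u_1,\dots,u_r$ are ordered $u_1<u_2<\dots<u_r$. For $1\le i\le 2^r-1$, write $i=\sum_{k=1}^r\epsilon_k(i)2^{k-1}$ with $\epsilon_k(i)\in\{0,1\}$ (binary expansion) and define the colour $\tilde u_i:=u_1^{\epsilon_1(i)}\cdots u_r^{\epsilon_r(i)}$; the colour $\tilde u_i$ "has $u_k$ as a primary colour" iff $\epsilon_k(i)=1$. Note $\tilde u_{2^{k-1}}=u_k$. For a colour $\tilde u_i$, $w(\tilde u_i)$ is the number of primary colours it contains, and $v(\tilde u_i)$ (resp. $z(\tilde u_i)$) is the smallest (resp. largest) primary colour it contains. For colours $\tilde u_i,\tilde u_j$, $\delta(\tilde u_i,\tilde u_j)=1$ if $z(\tilde u_i)<v(\tilde u_j)$ and $0$ otherwise. An overpartition into non-negative parts coloured $u_1,\dots,u_r$ is a finite multiset of coloured non-negative integers, each possibly overlined, such that for each colour $u_i$ and each value $m$ at most one part of value $m$ and colour $u_i$ is overlined (non-overlined parts may repeat); its generating function is $\prod_{k=1}^r (-u_k;q)_\infty/(du_k;q)_\infty$ with $d$ counting non-overlined parts, where $(a;q)_\infty=\prod_{j\ge0}(1-aq^j)$. -}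

module Defs where

open import Data.Nat using (ℕ; zero; suc; _+_; _^_; _≤_; _<_; _%_; _/_; _≡ᵇ_; _<ᵇ_)
open import Data.Fin using (Fin; toℕ)
open import Data.Bool using (Bool; true; false; if_then_else_)
open import Data.Nat.ListAction using (sum)
open import Data.List using (List; []; _∷_; map; filterᵇ; length; upTo)
open import Data.List.Relation.Unary.All using (All)
open import Data.List.Relation.Unary.Linked using (Linked)
open import Data.Vec using (Vec; tabulate)
open import Data.Product using (Σ; _×_; _,_; proj₁)
open import Data.Sum using (_⊎_)
open import Relation.Binary.PropositionalEquality using (_≡_)

countᵇ : {A : Set} → (A → Bool) → List A → ℕ
countᵇ p []       = 0
countᵇ p (x ∷ xs) = if p x then suc (countᵇ p xs) else countᵇ p xs

-- Overpartitions into non-negative parts coloured u_1,…,u_r  (D side)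
-- A part is (value , primary colour , overlined?).  Colour j : Fin r
-- stands for u_{j+1}.

DPart : ℕ → Set
DPart r = ℕ × Fin r × Bool

dval : ∀ {r} → DPart r → ℕ
dval (m , _ , _) = m

dcol : ∀ {r} → DPart r → Fin r
dcol (_ , i , _) = i

dover : ∀ {r} → DPart r → Bool
dover (_ , _ , b) = b

-- A multiset of parts is represented canonically by the list of its
-- elements sorted w.r.t. the total order: larger value first, then larger
-- colour index first, then overlined before non-overlined.
-- DStep p q : q may directly follow p in such a sorted list.  Equal parts
-- may be adjacent (repeat) only if they are non-overlined, which encodes
-- "at most one overlined part of each value and colour".
DStep : ∀ {r} → DPart r → DPart r → Set
DStep (m , i , b) (m' , i' , b') =
    (m' < m)
  ⊎ ((m' ≡ m) × (toℕ i' < toℕ i))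
  ⊎ ((m' ≡ m) × (i' ≡ i) × (b ≡ true) × (b' ≡ false))
  ⊎ ((m' ≡ m) × (i' ≡ i) × (b ≡ false) × (b' ≡ false))

isCol : ∀ {r} → Fin r → DPart r → Bool
isCol i (_ , j , _) = toℕ j ≡ᵇ toℕ i

nonOverᵈ : ∀ {r} → DPart r → Bool
nonOverᵈ (_ , _ , false) = true
nonOverᵈ (_ , _ , true)  = false

Dbar : (r : ℕ) → Vec ℕ r → ℕ → ℕ → Set
Dbar r ℓ k n =
  Σ (List (DPart r)) λ xs →
      Linked DStep xs
    × sum (map dval xs) ≡ n
    × tabulate (λ i → countᵇ (isCol i) xs) ≡ ℓ
    × countᵇ nonOverᵈ xs ≡ k

-- Colours ũ_i, 1 ≤ i ≤ 2^r − 1, via binary expansion (E side)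

bit : ℕ → ℕ → Bool
bit zero    i = (i % 2) ≡ᵇ 1
bit (suc j) i = bit j (i / 2)

-- 0-based indices j < r of the primary colours u_{j+1} contained in ũ_i,
-- in increasing order
primaries : ℕ → ℕ → List ℕ
primaries r i = filterᵇ (λ j → bit j i) (upTo r)

w : ℕ → ℕ → ℕ
w r i = length (primaries r i)

-- first / last element of a list (default 0 for the empty list; never
-- used for valid colours, which contain at least one primary colour)
firstOr0 : List ℕ → ℕ
firstOr0 []      = 0
firstOr0 (x ∷ _) = x

lastOr0 : List ℕ → ℕ
lastOr0 []           = 0
lastOr0 (x ∷ [])     = x
lastOr0 (_ ∷ y ∷ ys) = lastOr0 (y ∷ ys)

v : ℕ → ℕ → ℕ
v r i = firstOr0 (primaries r i)

z : ℕ → ℕ → ℕ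
z r i = lastOr0 (primaries r i)

δ : ℕ → ℕ → ℕ → ℕ
δ r i j = if z r i <ᵇ v r j then 1 else 0

-- a part of an E-sequence: (value , colour index i , overlined?)
EPart : Set
EPart = ℕ × ℕ × Bool

eval : EPart → ℕ
eval (m , _ , _) = m

χ : Bool → ℕ
χ true  = 1
χ false = 0

ValidCol : ℕ → EPart → Set
ValidCol r (_ , i , _) = (1 ≤ i) × (i < 2 ^ r)

-- condition between consecutive parts λ_t (first) and λ_{t+1} (second):
--   λ_t ≥ λ_{t+1}  and
--   λ_t − λ_{t+1} ≥ w(c(λ_{t+1})) + χ(λ̄_{t+1}) − 1 + δ(c(λ_t), c(λ_{t+1}))
-- (the latter written without subtraction over ℕ)
EStep : ℕ → EPart → EPart → Set
EStep r (a , ca , oa) (b , cb , ob) =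
  (b ≤ a) × (b + w r cb + χ ob + δ r ca cb ≤ a + 1)

hasPrimary : ℕ → EPart → Bool
hasPrimary j (_ , i , _) = bit j i

nonOverᵉ : EPart → Bool
nonOverᵉ (_ , _ , false) = true
nonOverᵉ (_ , _ , true)  = false

Ebar : (r : ℕ) → Vec ℕ r → ℕ → ℕ → Set
Ebar r ℓ k n =
  Σ (List EPart) λ xs →
      All (ValidCol r) xs
    × Linked (EStep r) xs
    × sum (map eval xs) ≡ n
    × tabulate (λ (j : Fin r) → countᵇ (hasPrimary (toℕ j)) xs) ≡ ℓ
    × countᵇ nonOverᵉ xs ≡ k

{-# OPTIONS --safe #-}
module Submission where

-- Write the colours ũ_i as increasing blocks of primary colours.  Concatenating the blocks
-- of a sequence counted by Ē gives a word y in the primary colours in which some ascents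
-- are interior to blocks; δ = 1 occurs exactly at the remaining ascents.  Subtracting the
-- minimal differences leaves a one-coloured overpartition, i.e. a set ω of overlined and a
-- multiset of non-overlined values.  If y has a ascents, then the subset of {0,…,a−1}
-- recording the interior ascents together with ω + a is an arbitrary finite set of naturals,
-- so Ē counts triples (word, set, multiset) subject only to the sizes of the set and the
-- multiset adding up to the length of y.
--
-- On the D̄ side list the overlined parts by increasing (value, colour), followed by the
-- non-overlined ones by decreasing (value, colour), and let y be the resulting colour word.
-- The values increase strictly at non-ascents of the overlined segment, and decrease strictly
-- at ascents of the other one, so removing these forced differences yields the same triples.
-- Both sides carry the weight maj(y) plus a common contribution of the set and the multiset.

open import Defs
open import Data.Bool using (Bool; true; false; if_then_else_; not; T)
open import Data.Empty using (⊥; ⊥-elim)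
open import Data.Fin using (Fin; zero; suc; toℕ)
open import Data.Fin.Properties using (toℕ-injective)
open import Data.List using (List; []; _∷_; map; length; _++_; reverse; _ʳ++_; zip; zipWith; filterᵇ; applyUpTo; upTo)
open import Data.List.Properties hiding (tabulate-cong)
open import Data.List.Relation.Unary.All using (All; []; _∷_)
import Data.List.Relation.Unary.All as All
open import Data.List.Relation.Unary.All.Properties using () renaming (map⁺ to All-map⁺)
open import Data.List.Relation.Unary.AllPairs using (AllPairs; []; _∷_)
open import Data.List.Relation.Unary.Linked using (Linked; []; [-]; _∷_)
import Data.List.Relation.Unary.Linked as Linked
open import Data.List.Relation.Unary.Linked.Properties using (AllPairs⇒Linked; Linked⇒AllPairs; map⁺; map⁻)
open import Data.Nat using (ℕ; zero; suc; _+_; _*_; _∸_; _^_; _/_; _%_; _≤_; _<_; _<ᵇ_; _≡ᵇ_; _≤?_; z≤n; s≤s)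
open import Data.Nat.DivMod using ([m+kn]%n≡m%n; +-distrib-/-∣ʳ; m*n/n≡m; m%n<n; m<n*o⇒m/o<n; m≡m%n+[m/n]*n)
open import Data.Nat.Divisibility using (n∣m*n)
open import Data.Nat.ListAction using (sum)
open import Data.Nat.Properties hiding (≡-irrelevant)
open import Data.Nat.Tactic.RingSolver using (solve-∀)
open import Data.Product using (Σ; ∃; _×_; _,_; proj₁; proj₂)
open import Data.Sum using (inj₁; inj₂)
open import Data.Unit using (⊤; tt)
open import Data.Vec using (Vec; tabulate)
open import Data.Vec.Properties using (tabulate-cong)
open import Function using (_∘_)
open import Function.Bundles using (_↔_; mk↔ₛ′)
open import Function.Properties.Inverse using (↔-trans)
open import Relation.Binary.Definitions using (Transitive)
open import Relation.Binary.PropositionalEquality using (_≡_; refl; sym; trans; cong; cong₂; subst; module ≡-Reasoning)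
open import Relation.Binary.PropositionalEquality.WithK using (≡-irrelevant)
open import Relation.Nullary using (¬_; Dec; yes; no; Irrelevant)

private
  variable
    r : ℕ
    C I X Y Z : Set

-- Statistic-preserving correspondences

-- A bijection between `P` and `Q` given as a relation, because its central instance comes from the
-- inductive relation `Flat`: uniqueness in either direction is then a plain induction, and
-- inversion and composition are immediate.
record Correspondence {X Y I : Set} (P : X → Set) (Q : Y → Set)
                      (s : X → I → ℕ) (t : Y → I → ℕ) : Set₁ where
  field
    R          : X → Y → Set
    sound      : ∀ {x y} → R x y → P x × Q y
    image      : ∀ {x} → P x → ∃ λ y → R x y
    preimage   : ∀ {y} → Q y → ∃ λ x → R x y
    functional : ∀ {x y y′} → R x y → R x y′ → y ≡ y′
    injective  : ∀ {x x′ y} → R x y → R x′ y → x ≡ x′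
    stat       : ∀ {x y} → R x y → ∀ i → s x i ≡ t y i

module _ {P : X → Set} {Q : Y → Set} {s : X → I → ℕ} {t : Y → I → ℕ} where

  open Correspondence

  fromInverses : (f : X → Y) (g : Y → X) →
                 (∀ {x} → P x → Q (f x)) → (∀ {y} → Q y → P (g y)) →
                 (∀ {x} → P x → g (f x) ≡ x) → (∀ {y} → Q y → f (g y) ≡ y) →
                 (∀ {x} → P x → ∀ i → s x i ≡ t (f x) i) →
                 Correspondence P Q s t
  fromInverses f g fQ gP gf fg st = record
    { R          = λ x y → P x × Q y × f x ≡ y
    ; sound      = λ (p , q , _) → p , q
    ; image      = λ p → _ , p , fQ p , refl
    ; preimage   = λ q → _ , gP q , q , fg q
    ; functional = λ (_ , _ , e) (_ , _ , e′) → trans (sym e) e′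
    ; injective  = λ (p , _ , e) (p′ , _ , e′) →
                     trans (sym (gf p)) (trans (cong g (trans e (sym e′))) (gf p′))
    ; stat       = λ { (p , _ , refl) i → st p i }
    }

  flip : Correspondence P Q s t → Correspondence Q P t s
  flip c = record
    { R          = λ y x → R c x y
    ; sound      = λ h → let p , q = sound c h in q , p
    ; image      = preimage c
    ; preimage   = image c
    ; functional = injective c
    ; injective  = functional c
    ; stat       = λ h i → sym (stat c h i)
    }

  infixr 4 _⨾_

  _⨾_ : {S : Z → Set} {u : Z → I → ℕ} →
        Correspondence P Q s t → Correspondence Q S t u → Correspondence P S s u
  c ⨾ d = record
    { R          = λ x z → ∃ λ y → R c x y × R d y z
    ; sound      = λ (_ , h , k) → proj₁ (sound c h) , proj₂ (sound d k)
    ; image      = λ p → let y , h = image c p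
                             z , k = image d (proj₂ (sound c h)) in z , y , h , k
    ; preimage   = λ q → let y , k = preimage d q
                             x , h = preimage c (proj₁ (sound d k)) in x , y , h , k
    ; functional = λ { (_ , h , k) (_ , h′ , k′) → func h h′ k k′ }
    ; injective  = λ { (_ , h , k) (_ , h′ , k′) → inj h h′ k k′ }
    ; stat       = λ (_ , h , k) i → trans (stat c h i) (stat d k i)
    }
    where
    func : ∀ {x y y′ z z′} → R c x y → R c x y′ → R d y z → R d y′ z′ → z ≡ z′
    func h h′ k k′ with functional c h h′
    ... | refl = functional d k k′

    inj : ∀ {x x′ y y′ z} → R c x y → R c x′ y′ → R d y z → R d y′ z → x ≡ x′
    inj h h′ k k′ with injective d k k′
    ... | refl = injective c h h′

-- Lists with prescribed minimal gaps

Gapped : (C → C → ℕ) → ℕ × C → ℕ × C → Set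
Gapped e (v , x) (v′ , x′) = v′ + e x x′ ≤ v

-- The least value admissible in front of the list. It is 0 before the empty list, so the gap of the
-- last part is its value.
need : (C → C → ℕ) → C → List (ℕ × C) → ℕ
need e x []             = 0
need e x ((v , y) ∷ _)  = v + e x y

gap : (C → C → ℕ) → List (ℕ × C) → List (ℕ × C)
gap e []             = []
gap e ((v , x) ∷ vs) = (v ∸ need e x vs , x) ∷ gap e vs

ungap : (C → C → ℕ) → List (ℕ × C) → List (ℕ × C)
ungap e []             = []
ungap e ((g , x) ∷ gs) = (g + need e x (ungap e gs) , x) ∷ ungap e gs

Linked-ungap : ∀ (e : C → C → ℕ) gs → Linked (Gapped e) (ungap e gs)
Linked-ungap e []             = []
Linked-ungap e (_ ∷ [])       = [-]
Linked-ungap e ((h , x) ∷ g ∷ gs) = m≤n+m (need e x (ungap e (g ∷ gs))) h ∷ Linked-ungap e (g ∷ gs)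

gap-ungap : ∀ (e : C → C → ℕ) gs → gap e (ungap e gs) ≡ gs
gap-ungap e []             = refl
gap-ungap e ((g , x) ∷ gs) =
  cong₂ (λ h t → (h , x) ∷ t) (m+n∸n≡m g (need e x (ungap e gs))) (gap-ungap e gs)

ungap-gap : ∀ (e : C → C → ℕ) {vs} → Linked (Gapped e) vs → ungap e (gap e vs) ≡ vs
ungap-gap e []                = refl
ungap-gap e {(v , x) ∷ []} [-] = cong (λ h → (h , x) ∷ []) (+-identityʳ v)
ungap-gap e {(v , x) ∷ vs@((v′ , y) ∷ _)} (p ∷ ps) =
  trans (cong (λ t → (v ∸ need e x vs + need e x t , x) ∷ t) (ungap-gap e ps))
        (cong (λ h → (h , x) ∷ vs) (m∸n+n≡m p))

map-proj₂-ungap : ∀ (e : C → C → ℕ) gs → map proj₂ (ungap e gs) ≡ map proj₂ gs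
map-proj₂-ungap e []             = refl
map-proj₂-ungap e ((_ , x) ∷ gs) = cong (x ∷_) (map-proj₂-ungap e gs)

adj : (C → C → ℕ) → List C → ℕ
adj e []            = 0
adj e (x ∷ [])      = 0
adj e (x ∷ y ∷ xs)  = e x y + adj e (y ∷ xs)

-- maj e xs = Σ t · e (x_t) (x_{t+1}), a weighted major index.
maj : (C → C → ℕ) → List C → ℕ
maj e []       = 0
maj e (x ∷ xs) = adj e (x ∷ xs) + maj e xs

-- The sum of t·g_t with t counted from 1: the t-th gap of a decreasing list raises the first t
-- values.
weightedSum : List ℕ → ℕ
weightedSum []       = 0
weightedSum (g ∷ gs) = g + sum gs + weightedSum gs

-- The values telescope: every later gap and every minimal difference from `x` on enters once.
need-ungap : ∀ (e : C → C → ℕ) x gs →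
             need e x (ungap e gs) ≡ sum (map proj₁ gs) + adj e (x ∷ map proj₂ gs)
need-ungap e x []             = refl
need-ungap e x ((g , y) ∷ gs) rewrite need-ungap e y gs =
  lemma g (sum (map proj₁ gs)) _ (e x y)
  where
  lemma : ∀ g s a b → g + (s + a) + b ≡ g + s + (b + a)
  lemma = solve-∀

sum-ungap : ∀ (e : C → C → ℕ) gs →
            sum (map proj₁ (ungap e gs)) ≡ weightedSum (map proj₁ gs) + maj e (map proj₂ gs)
sum-ungap e []             = refl
sum-ungap e ((g , x) ∷ gs) rewrite need-ungap e x gs | sum-ungap e gs =
  lemma g (sum (map proj₁ gs)) _ _ _
  where
  lemma : ∀ g s a t m → g + (s + a) + (t + m) ≡ g + s + t + (a + m)
  lemma = solve-∀

-- Overpartitions as pairs of gap lists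

less : Fin r → Fin r → Bool
less x y = toℕ x <ᵇ toℕ y

asc nonDesc : Fin r → Fin r → ℕ
asc x y     = χ (less x y)
nonDesc x y = χ (not (less y x))

-- The forced difference depends on the flag of the later part alone: among equal values an
-- overlined part must follow a strictly larger colour, a non-overlined one a weakly larger colour.
gapFor : Bool → Fin r → Fin r → ℕ
gapFor true  = nonDesc
gapFor false = asc

DGapped : DPart r → DPart r → Set
DGapped (v , x , _) (v′ , x′ , b′) = Gapped (gapFor b′) (v , x) (v′ , x′)

less-true : ∀ {x y : Fin r} → toℕ x < toℕ y → less x y ≡ true
less-true {x = x} {y} p with less x y | <⇒<ᵇ p
... | true | _ = refl

less-false : ∀ {x y : Fin r} → toℕ y ≤ toℕ x → less x y ≡ false
less-false {x = x} {y} p with less x y in eq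
... | false = refl
... | true  = ⊥-elim (≤⇒≯ p (<ᵇ⇒< (toℕ x) (toℕ y) (subst T (sym eq) tt)))

less-true⁻ : ∀ {x y : Fin r} → less x y ≡ true → toℕ x < toℕ y
less-true⁻ {x = x} {y} eq = <ᵇ⇒< (toℕ x) (toℕ y) (subst T (sym eq) tt)

less-false⁻ : ∀ {x y : Fin r} → less x y ≡ false → toℕ y ≤ toℕ x
less-false⁻ {x = x} {y} eq with toℕ y ≤? toℕ x
... | yes p = p
... | no ¬p with trans (sym eq) (less-true {x = x} {y} (≰⇒> ¬p))
... | ()

χ≤1 : ∀ b → χ b ≤ 1
χ≤1 true  = s≤s z≤n
χ≤1 false = z≤n

DStep⇒DGapped : ∀ {p q : DPart r} → DStep p q → DGapped p q
DStep⇒DGapped {p = v , x , _} {v′ , x′ , b′} (inj₁ lt) =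
  ≤-trans (+-monoʳ-≤ v′ (bound b′)) (≤-trans (≤-reflexive (+-comm v′ 1)) lt)
  where
  bound : ∀ b → gapFor b x x′ ≤ 1
  bound true  = χ≤1 _
  bound false = χ≤1 _
DStep⇒DGapped {p = v , x , _} {v′ , x′ , true} (inj₂ (inj₁ (refl , lt)))
  rewrite less-true {x = x′} {x} lt = ≤-reflexive (+-identityʳ v)
DStep⇒DGapped {p = v , x , _} {v′ , x′ , false} (inj₂ (inj₁ (refl , lt)))
  rewrite less-false {x = x} {x′} (<⇒≤ lt) = ≤-reflexive (+-identityʳ v)
DStep⇒DGapped {p = v , x , _} (inj₂ (inj₂ (inj₁ (refl , refl , refl , refl))))
  rewrite less-false {x = x} {x} ≤-refl = ≤-reflexive (+-identityʳ v)
DStep⇒DGapped {p = v , x , _} (inj₂ (inj₂ (inj₂ (refl , refl , refl , refl))))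
  rewrite less-false {x = x} {x} ≤-refl = ≤-reflexive (+-identityʳ v)

DGapped⇒DStep : ∀ {p q : DPart r} → DGapped p q → DStep p q
DGapped⇒DStep {p = v , x , b} {v′ , x′ , b′} h with m≤n⇒m<n∨m≡n (m+n≤o⇒m≤o v′ h)
... | inj₁ lt = inj₁ lt
DGapped⇒DStep {p = v , x , b} {v′ , x′ , true} h | inj₂ refl with less x′ x in eq
... | true  = inj₂ (inj₁ (refl , less-true⁻ {x = x′} {x} eq))
... | false = ⊥-elim (m+1+n≰m v h)
DGapped⇒DStep {p = v , x , b} {v′ , x′ , false} h | inj₂ refl with less x x′ in eq
... | true  = ⊥-elim (m+1+n≰m v h)
... | false with m≤n⇒m<n∨m≡n (less-false⁻ {x = x} {x′} eq)
...   | inj₁ lt = inj₂ (inj₁ (refl , lt))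
...   | inj₂ e with b
...     | true  = inj₂ (inj₂ (inj₁ (refl , toℕ-injective e , refl , refl)))
...     | false = inj₂ (inj₂ (inj₂ (refl , toℕ-injective e , refl , refl)))

-- If `x` and `z` force a difference but `y` and `z` do not, then `x` is strictly below `y`, which
-- forces a difference under either flag `b′`. This makes `DGapped` transitive, so that sublists of
-- sorted lists are sorted.
gapFor-triangle : ∀ b b′ (x y z : Fin r) → gapFor b x z ≤ gapFor b y z + gapFor b′ x y
gapFor-triangle false b′ x y z with less x z in xz
... | false = z≤n
... | true with less y z in yz
...   | true  = s≤s z≤n
...   | false with b′
...     | false rewrite less-true {x = x} {y} (<-≤-trans (less-true⁻ {x = x} {z} xz) (less-false⁻ {x = y} {z} yz)) = ≤-refl
...     | true  rewrite less-false {x = y} {x} (<⇒≤ (<-≤-trans (less-true⁻ {x = x} {z} xz) (less-false⁻ {x = y} {z} yz))) = ≤-refl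
gapFor-triangle true b′ x y z with less z x in zx
... | true  = z≤n
... | false with less z y in zy
...   | false = s≤s z≤n
...   | true with b′
...     | false rewrite less-true {x = x} {y} (≤-<-trans (less-false⁻ {x = z} {x} zx) (less-true⁻ {x = z} {y} zy)) = ≤-refl
...     | true  rewrite less-false {x = y} {x} (<⇒≤ (≤-<-trans (less-false⁻ {x = z} {x} zx) (less-true⁻ {x = z} {y} zy))) = ≤-refl

DGapped-trans : Transitive (DGapped {r})
DGapped-trans {i = v , x , _} {v′ , x′ , b′} {v″ , x″ , b″} p q = begin
  v″ + gapFor b″ x x″                          ≤⟨ +-monoʳ-≤ v″ (gapFor-triangle b″ b′ x x′ x″) ⟩
  v″ + (gapFor b″ x′ x″ + gapFor b′ x x′)      ≡⟨ +-assoc v″ _ _ ⟨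
  v″ + gapFor b″ x′ x″ + gapFor b′ x x′        ≤⟨ +-monoˡ-≤ _ q ⟩
  v′ + gapFor b′ x x′                          ≤⟨ p ⟩
  v                                            ∎
  where open ≤-Reasoning

Gapped-trans : ∀ b → Transitive (Gapped (gapFor {r} b))
Gapped-trans b {v , x} {v′ , x′} {v″ , x″} =
  DGapped-trans {i = v , x , b} {v′ , x′ , b} {v″ , x″ , b}

-- Together with `¬asc⇒nonDesc`: an overlined `k` and a non-overlined `l` can stand in exactly one
-- order, so the interleaving of the two sublists is determined.
asc⇒¬nonDesc : ∀ {k l : ℕ × Fin r} → Gapped asc k l → ¬ Gapped nonDesc l k
asc⇒¬nonDesc {k = v , x} {v′ , x′} p q with less x x′
... | true  = <-irrefl refl (≤-trans (≤-trans (≤-reflexive (+-comm 1 v′)) p) (≤-trans (≤-reflexive (sym (+-identityʳ v))) q))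
... | false = <-irrefl refl (≤-trans (≤-trans (≤-reflexive (+-comm 1 v)) q) (≤-trans (≤-reflexive (sym (+-identityʳ v′))) p))

¬asc⇒nonDesc : ∀ {k l : ℕ × Fin r} → ¬ Gapped asc k l → Gapped nonDesc l k
¬asc⇒nonDesc {k = v , x} {v′ , x′} ¬p with less x x′
... | true  = ≤-trans (≤-reflexive (+-identityʳ v)) (≤-pred (≤-trans (≰⇒> ¬p) (≤-reflexive (+-comm v′ 1))))
... | false = ≤-trans (≤-reflexive (+-comm v 1)) (≤-trans (≰⇒> ¬p) (≤-reflexive (+-identityʳ v′)))

overlined plain : List (DPart r) → List (ℕ × Fin r)
overlined []                      = []
overlined ((v , x , true)  ∷ ps)  = (v , x) ∷ overlined ps
overlined ((v , x , false) ∷ ps)  = overlined ps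
plain []                          = []
plain ((v , x , true)  ∷ ps)      = plain ps
plain ((v , x , false) ∷ ps)      = (v , x) ∷ plain ps

over nonover : ℕ × Fin r → DPart r
over    (v , x) = v , x , true
nonover (v , x) = v , x , false

asc? : (k l : ℕ × Fin r) → Dec (Gapped asc k l)
asc? (v , x) (v′ , x′) = v′ + asc x x′ ≤? v

choose : {A B : Set} → Dec A → B → B → B
choose (yes _) t f = t
choose (no  _) t f = f

merge : List (ℕ × Fin r) → List (ℕ × Fin r) → List (DPart r)
merge []       ns       = map nonover ns
merge (o ∷ os) []       = over o ∷ merge os []
merge (o ∷ os) (n ∷ ns) =
  choose (asc? o n) (over o ∷ merge os (n ∷ ns)) (nonover n ∷ merge (o ∷ os) ns)

overlined-merge : ∀ (os ns : List (ℕ × Fin r)) → overlined (merge os ns) ≡ os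
overlined-merge []       []       = refl
overlined-merge []       (n ∷ ns) = overlined-merge [] ns
overlined-merge (o ∷ os) []       = cong (o ∷_) (overlined-merge os [])
overlined-merge (o ∷ os) (n ∷ ns)
  with asc? o n | overlined-merge os (n ∷ ns) | overlined-merge (o ∷ os) ns
... | yes _ | ih | _  = cong (o ∷_) ih
... | no  _ | _  | ih = ih

plain-merge : ∀ (os ns : List (ℕ × Fin r)) → plain (merge os ns) ≡ ns
plain-merge []       []       = refl
plain-merge []       (n ∷ ns) = cong (n ∷_) (plain-merge [] ns)
plain-merge (o ∷ os) []       = plain-merge os []
plain-merge (o ∷ os) (n ∷ ns)
  with asc? o n | plain-merge os (n ∷ ns) | plain-merge (o ∷ os) ns
... | yes _ | ih | _  = ih
... | no  _ | _  | ih = cong (n ∷_) ih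

All-merge : ∀ {P : DPart r → Set} {os ns} →
            All (P ∘ over) os → All (P ∘ nonover) ns → All P (merge os ns)
All-merge []       []       = []
All-merge []       (q ∷ qs) = q ∷ All-merge [] qs
All-merge (p ∷ ps) []       = p ∷ All-merge ps []
All-merge {os = o ∷ os} {n ∷ ns} (p ∷ ps) (q ∷ qs)
  with asc? o n | All-merge ps (q ∷ qs) | All-merge (p ∷ ps) qs
... | yes _ | ih | _  = p ∷ ih
... | no  _ | _  | ih = q ∷ ih

AllPairs-merge : ∀ {os ns : List (ℕ × Fin r)} →
                 AllPairs (Gapped nonDesc) os → AllPairs (Gapped asc) ns →
                 AllPairs DGapped (merge os ns)
AllPairs-merge []       []       = []
AllPairs-merge []       (q ∷ qs) = All-merge [] q ∷ AllPairs-merge [] qs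
AllPairs-merge (p ∷ ps) []       = All-merge p [] ∷ AllPairs-merge ps []
AllPairs-merge {os = o ∷ os} {n ∷ ns} (p ∷ ps) (q ∷ qs)
  with asc? o n | AllPairs-merge ps (q ∷ qs) | AllPairs-merge (p ∷ ps) qs
-- `o` may precede `n`, hence by transitivity every later non-overlined part too.
... | yes h | ih | _  = All-merge p (h ∷ All.map (λ {k} → Gapped-trans false {o} {n} {k} h) q) ∷ ih
... | no ¬h | _  | ih = All-merge (h ∷ All.map (λ {k} → Gapped-trans true {n} {o} {k} h) p) q ∷ ih
  where h = ¬asc⇒nonDesc {k = o} {n} ¬h

All-overlined : ∀ {P : DPart r → Set} {ps} → All P ps → All (P ∘ over) (overlined ps)
All-overlined []                               = []
All-overlined {ps = (_ , _ , true)  ∷ _} (p ∷ ps) = p ∷ All-overlined ps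
All-overlined {ps = (_ , _ , false) ∷ _} (p ∷ ps) = All-overlined ps

All-plain : ∀ {P : DPart r → Set} {ps} → All P ps → All (P ∘ nonover) (plain ps)
All-plain []                               = []
All-plain {ps = (_ , _ , true)  ∷ _} (p ∷ ps) = All-plain ps
All-plain {ps = (_ , _ , false) ∷ _} (p ∷ ps) = p ∷ All-plain ps

AllPairs-overlined : ∀ {ps : List (DPart r)} →
                     AllPairs DGapped ps → AllPairs (Gapped nonDesc) (overlined ps)
AllPairs-overlined []                                  = []
AllPairs-overlined {ps = (_ , _ , true)  ∷ _} (p ∷ ps) = All-overlined p ∷ AllPairs-overlined ps
AllPairs-overlined {ps = (_ , _ , false) ∷ _} (p ∷ ps) = AllPairs-overlined ps

AllPairs-plain : ∀ {ps : List (DPart r)} →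
                 AllPairs DGapped ps → AllPairs (Gapped asc) (plain ps)
AllPairs-plain []                                  = []
AllPairs-plain {ps = (_ , _ , true)  ∷ _} (p ∷ ps) = AllPairs-plain ps
AllPairs-plain {ps = (_ , _ , false) ∷ _} (p ∷ ps) = All-plain p ∷ AllPairs-plain ps

merge-over : ∀ {o : ℕ × Fin r} {os ns} → All (Gapped asc o) ns →
             merge (o ∷ os) ns ≡ over o ∷ merge os ns
merge-over []      = refl
merge-over {o = o} {ns = n ∷ _} (h ∷ _) with asc? o n
... | yes _ = refl
... | no ¬h = ⊥-elim (¬h h)

merge-nonover : ∀ {n : ℕ × Fin r} {os ns} → All (Gapped nonDesc n) os →
                merge os (n ∷ ns) ≡ nonover n ∷ merge os ns
merge-nonover []                    = refl
merge-nonover {n = n} {o ∷ _} (h ∷ _) with asc? o n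
... | yes g = ⊥-elim (asc⇒¬nonDesc {k = o} {n} g h)
... | no  _ = refl

-- The first part of a sorted list may precede all others, which forces every choice made by
-- `merge`.
merge-split : ∀ {ps : List (DPart r)} → AllPairs DGapped ps →
              merge (overlined ps) (plain ps) ≡ ps
merge-split []                                  = refl
merge-split {ps = (v , x , true)  ∷ _} (p ∷ ps) =
  trans (merge-over (All-plain p)) (cong (_ ∷_) (merge-split ps))
merge-split {ps = (v , x , false) ∷ _} (p ∷ ps) =
  trans (merge-nonover (All-overlined p)) (cong (_ ∷_) (merge-split ps))

data Statistic (r : ℕ) : Set where
  colour     : Fin r → Statistic r
  nonOverlined total : Statistic r

count : Fin r → List (Fin r) → ℕ
count i = countᵇ (λ j → toℕ j ≡ᵇ toℕ i)

statD : List (DPart r) → Statistic r → ℕ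
statD ps (colour i)   = countᵇ (isCol i) ps
statD ps nonOverlined = countᵇ nonOverᵈ ps
statD ps total        = sum (map dval ps)

GapPair : ℕ → Set
GapPair r = List (ℕ × Fin r) × List (ℕ × Fin r)

statG : GapPair r → Statistic r → ℕ
statG (as , bs) (colour i)   = count i (map proj₂ as) + count i (map proj₂ bs)
statG (as , bs) nonOverlined = length bs
statG (as , bs) total        = (weightedSum (map proj₁ as) + maj nonDesc (map proj₂ as))
                             + (weightedSum (map proj₁ bs) + maj asc (map proj₂ bs))

statSplit : List (DPart r) → Statistic r → ℕ
statSplit ps (colour i)   = count i (map proj₂ (overlined ps)) + count i (map proj₂ (plain ps))
statSplit ps nonOverlined = length (plain ps)
statSplit ps total        = sum (map proj₁ (overlined ps)) + sum (map proj₁ (plain ps))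

statD-split : ∀ (ps : List (DPart r)) s → statSplit ps s ≡ statD ps s
statD-split [] (colour i)   = refl
statD-split [] nonOverlined = refl
statD-split [] total        = refl
statD-split ((v , x , true) ∷ ps) (colour i) with toℕ x ≡ᵇ toℕ i
... | true  = cong suc (statD-split ps (colour i))
... | false = statD-split ps (colour i)
statD-split ((v , x , true) ∷ ps) nonOverlined = statD-split ps nonOverlined
statD-split ((v , x , true) ∷ ps) total =
  trans (+-assoc v _ _) (cong (v +_) (statD-split ps total))
statD-split ((v , x , false) ∷ ps) (colour i) with toℕ x ≡ᵇ toℕ i
... | true  = trans (+-suc _ _) (cong suc (statD-split ps (colour i)))
... | false = statD-split ps (colour i)
statD-split ((v , x , false) ∷ ps) nonOverlined = cong suc (statD-split ps nonOverlined)
statD-split ((v , x , false) ∷ ps) total =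
  trans (lemma (sum (map proj₁ (overlined ps))) v _) (cong (v +_) (statD-split ps total))
  where
  lemma : ∀ a b c → a + (b + c) ≡ b + (a + c)
  lemma = solve-∀

length-ungap : ∀ (e : C → C → ℕ) gs → length (ungap e gs) ≡ length gs
length-ungap e []       = refl
length-ungap e (_ ∷ gs) = cong suc (length-ungap e gs)

-- Overlined parts have minimal differences `nonDesc`, the others `asc`. Once these are removed both
-- gap lists are arbitrary, hence the trivial condition on the left.
gapPairs↔overpartitions : Correspondence {I = Statistic r} (λ _ → ⊤) (Linked DStep) statG statD
gapPairs↔overpartitions {r} = fromInverses
  (λ (as , bs) → merge (ungap nonDesc as) (ungap asc bs))
  (λ ps → gap nonDesc (overlined ps) , gap asc (plain ps))
  (λ {(as , bs)} _ → Linked.map DGapped⇒DStep (AllPairs⇒Linked (AllPairs-merge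
     (Linked⇒AllPairs (λ {i j k} → Gapped-trans true {i} {j} {k}) (Linked-ungap nonDesc as))
     (Linked⇒AllPairs (λ {i j k} → Gapped-trans false {i} {j} {k}) (Linked-ungap asc bs)))))
  (λ _ → tt)
  (λ {(as , bs)} _ → cong₂ _,_
     (trans (cong (gap nonDesc) (overlined-merge (ungap nonDesc as) (ungap asc bs))) (gap-ungap nonDesc as))
     (trans (cong (gap asc) (plain-merge (ungap nonDesc as) (ungap asc bs))) (gap-ungap asc bs)))
  (λ {ps} h → let h′ = Linked⇒AllPairs (λ {i j k} → DGapped-trans {r} {i} {j} {k}) (Linked.map DStep⇒DGapped h) in
     trans (cong₂ merge (ungap-gap nonDesc (AllPairs⇒Linked (AllPairs-overlined h′)))
                        (ungap-gap asc (AllPairs⇒Linked (AllPairs-plain h′))))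
           (merge-split h′))
  (λ {(as , bs)} _ s → trans (stat-ungap as bs s)
     (statD-split (merge (ungap nonDesc as) (ungap asc bs)) s))
  where
  stat-ungap : ∀ (as bs : List (ℕ × Fin r)) s →
               statG (as , bs) s ≡ statSplit (merge (ungap nonDesc as) (ungap asc bs)) s
  stat-ungap as bs s with merge (ungap nonDesc as) (ungap asc bs)
                        | overlined-merge (ungap nonDesc as) (ungap asc bs)
                        | plain-merge (ungap nonDesc as) (ungap asc bs)
  stat-ungap as bs (colour i) | ps | p | q
    rewrite p | q | map-proj₂-ungap nonDesc as | map-proj₂-ungap asc bs = refl
  stat-ungap as bs nonOverlined | ps | p | q
    rewrite q = sym (length-ungap asc bs)
  stat-ungap as bs total | ps | p | q
    rewrite p | q = sym (cong₂ _+_ (sum-ungap nonDesc as) (sum-ungap asc bs))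

-- Overpartitions in one colour

χGap : Bool → Bool → ℕ
χGap _ b = χ b

statP : List (ℕ × Bool) → Statistic 1 → ℕ
statP ps (colour _)   = length ps
statP ps nonOverlined = countᵇ (not ∘ proj₂) ps
statP ps total        = weightedSum (map proj₁ ps) + maj χGap (map proj₂ ps)

withColour : ℕ × Bool → DPart 1
withColour (v , b) = v , zero , b

withoutColour : DPart 1 → ℕ × Bool
withoutColour (v , _ , b) = v , b

-- With a single colour `nonDesc` is constantly 1 and `asc` constantly 0, so the minimal difference
-- is `χ` of the later flag.
flags↔overpartitions : Correspondence (λ _ → ⊤) (Linked (DStep {1})) statP statD
flags↔overpartitions = fromInverses
  (map withColour ∘ ungap χGap) (gap χGap ∘ map withoutColour)
  (λ {ps} _ → map⁺ (Linked.map (λ {p} {q} → toDStep {p} {q}) (Linked-ungap χGap ps)))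
  (λ _ → tt)
  (λ {ps} _ → trans (cong (gap χGap) (trans (sym (map-∘ (ungap χGap ps))) (map-id (ungap χGap ps))))
                    (gap-ungap χGap ps))
  (λ {xs} h → trans (cong (map withColour) (ungap-gap χGap (map⁺ (Linked.map fromDStep h))))
                    (with-without xs))
  (λ {ps} _ → stats ps)
  where
  toDStep : ∀ {p q} → Gapped χGap p q → DStep (withColour p) (withColour q)
  toDStep {q = _ , true}  h = DGapped⇒DStep h
  toDStep {q = _ , false} h = DGapped⇒DStep h

  fromDStep : ∀ {p q} → DStep p q → Gapped χGap (withoutColour p) (withoutColour q)
  fromDStep {p = _ , zero , _} {_ , zero , true}  h = DStep⇒DGapped h
  fromDStep {p = _ , zero , _} {_ , zero , false} h = DStep⇒DGapped h

  with-without : ∀ xs → map withColour (map withoutColour xs) ≡ xs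
  with-without []                   = refl
  with-without ((_ , zero , _) ∷ xs) = cong (_ ∷_) (with-without xs)

  stats : ∀ ps s → statP ps s ≡ statD (map withColour (ungap χGap ps)) s
  stats []                 (colour zero) = refl
  stats (_ ∷ ps)           (colour zero) = cong suc (stats ps (colour zero))
  stats []                 nonOverlined  = refl
  stats ((_ , true)  ∷ ps) nonOverlined  = stats ps nonOverlined
  stats ((_ , false) ∷ ps) nonOverlined  = cong suc (stats ps nonOverlined)
  stats ps                 total         =
    sym (trans (cong sum (sym (map-∘ (ungap χGap ps)))) (sum-ungap χGap ps))

-- The binomial coefficient n choose 2.
triangle : ℕ → ℕ
triangle zero    = 0
triangle (suc n) = n + triangle n

-- If gs are the gaps of a set of integers listed increasingly, then risingSum gs
-- is the sum of the elements minus triangle of their number.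
risingSum : List ℕ → ℕ
risingSum []       = 0
risingSum (g ∷ gs) = g * suc (length gs) + risingSum gs

-- A gap raises the elements on its large side, which precede it in decreasing order and follow it
-- in increasing order. Each gap of `gs` also raises all elements belonging to `hs`.
risingSum-ʳ++ : ∀ gs hs → risingSum (gs ʳ++ hs) ≡ weightedSum gs + sum gs * length hs + risingSum hs
risingSum-ʳ++ []       hs = refl
risingSum-ʳ++ (g ∷ gs) hs =
  trans (risingSum-ʳ++ gs (g ∷ hs)) (lemma g (sum gs) (weightedSum gs) (length hs) (risingSum hs))
  where
  lemma : ∀ g s t n u → t + s * suc n + (g * suc n + u) ≡ g + s + t + (g + s) * n + u
  lemma = solve-∀

risingSum-reverse : ∀ gs → risingSum (reverse gs) ≡ weightedSum gs
risingSum-reverse gs = trans (risingSum-ʳ++ gs []) (lemma (weightedSum gs) (sum gs))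
  where
  lemma : ∀ t s → t + s * 0 + 0 ≡ t
  lemma = solve-∀

-- `as` holds the gaps of a set listed increasingly, `bs` those of a multiset listed decreasingly.
statN : List ℕ × List ℕ → Statistic 1 → ℕ
statN (as , bs) (colour _)   = length as + length bs
statN (as , bs) nonOverlined = length bs
statN (as , bs) total        = risingSum as + triangle (length as) + weightedSum bs

uncoloured↔gapPairs : Correspondence (λ _ → ⊤) (λ _ → ⊤) statN (statG {1})
uncoloured↔gapPairs = fromInverses
  (λ (as , bs) → map c₀ (reverse as) , map c₀ bs)
  (λ (as , bs) → reverse (map proj₁ as) , map proj₁ bs)
  (λ _ → tt) (λ _ → tt)
  (λ {(as , bs)} _ → cong₂ _,_ (trans (cong reverse (proj₁-c₀ (reverse as))) (reverse-involutive as)) (proj₁-c₀ bs))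
  (λ {(as , bs)} _ → cong₂ _,_ (trans (cong (map c₀) (reverse-involutive (map proj₁ as))) (c₀-proj₁ as)) (c₀-proj₁ bs))
  (λ {(as , bs)} _ → stats as bs)
  where
  c₀ : ℕ → ℕ × Fin 1
  c₀ g = g , zero

  proj₁-c₀ : ∀ gs → map proj₁ (map c₀ gs) ≡ gs
  proj₁-c₀ []       = refl
  proj₁-c₀ (g ∷ gs) = cong (g ∷_) (proj₁-c₀ gs)

  c₀-proj₁ : ∀ gs → map c₀ (map proj₁ gs) ≡ gs
  c₀-proj₁ []                = refl
  c₀-proj₁ ((g , zero) ∷ gs) = cong (_ ∷_) (c₀-proj₁ gs)

  count-c₀ : ∀ gs → count zero (map proj₂ (map c₀ gs)) ≡ length gs
  count-c₀ []       = refl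
  count-c₀ (_ ∷ gs) = cong suc (count-c₀ gs)

  adj-nonDesc : ∀ g gs → adj nonDesc (map proj₂ (map c₀ (g ∷ gs))) ≡ length gs
  adj-nonDesc _ []       = refl
  adj-nonDesc _ (g ∷ gs) = cong suc (adj-nonDesc g gs)

  maj-nonDesc : ∀ gs → maj nonDesc (map proj₂ (map c₀ gs)) ≡ triangle (length gs)
  maj-nonDesc []       = refl
  maj-nonDesc (g ∷ gs) = cong₂ _+_ (adj-nonDesc g gs) (maj-nonDesc gs)

  adj-asc : ∀ gs → adj asc (map proj₂ (map c₀ gs)) ≡ 0
  adj-asc []           = refl
  adj-asc (_ ∷ [])     = refl
  adj-asc (_ ∷ g ∷ gs) = adj-asc (g ∷ gs)

  maj-asc : ∀ gs → maj asc (map proj₂ (map c₀ gs)) ≡ 0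
  maj-asc []       = refl
  maj-asc (g ∷ gs) = cong₂ _+_ (adj-asc (g ∷ gs)) (maj-asc gs)

  stats : ∀ as bs s → statN (as , bs) s ≡ statG (map c₀ (reverse as) , map c₀ bs) s
  stats as bs (colour zero) = cong₂ _+_
    (sym (trans (count-c₀ (reverse as)) (length-reverse as))) (sym (count-c₀ bs))
  stats as bs nonOverlined = sym (length-map c₀ bs)
  stats as bs total = sym (cong₂ _+_
    (cong₂ _+_ (trans (cong weightedSum (proj₁-c₀ (reverse as)))
                      (trans (sym (risingSum-reverse (reverse as)))
                             (cong risingSum (reverse-involutive as))))
               (trans (maj-nonDesc (reverse as)) (cong triangle (length-reverse as))))
    (trans (cong₂ _+_ (cong weightedSum (proj₁-c₀ bs)) (maj-asc bs)) (+-identityʳ _)))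

-- A flagged gap sequence encodes a one-coloured overpartition, which in turn splits into the set of
-- its overlined and the multiset of its non-overlined values.
flags↔uncoloured : Correspondence (λ _ → ⊤) (λ _ → ⊤) statP statN
flags↔uncoloured =
  flags↔overpartitions ⨾ flip gapPairs↔overpartitions ⨾ flip uncoloured↔gapPairs

-- Words and block decompositions

Ascending : List (Fin r) → Set
Ascending []       = ⊥
Ascending (x ∷ xs) = Linked (λ y z → less y z ≡ true) (x ∷ xs)

-- The counterpart of `δ`, see `joint-δ`. The values at empty lists are defaults; `Ascending`
-- excludes empty blocks.
joint : List (Fin r) → List (Fin r) → ℕ
joint []           _       = 0
joint (x ∷ [])     []      = 0
joint (x ∷ [])     (y ∷ _) = asc x y
joint (_ ∷ x ∷ xs) ys      = joint (x ∷ xs) ys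

-- This is w - 1 + δ: the ascents inside the second block, and the one possibly formed where the two
-- blocks meet.
blockGap : List (Fin r) → List (Fin r) → ℕ
blockGap b b′ = length b′ ∸ 1 + joint b b′

blockCount : Fin r → List (List (Fin r)) → ℕ
blockCount i []       = 0
blockCount i (b ∷ bs) = count i b + blockCount i bs

-- Flat c G y Γ: the blocks c concatenate to the word y, and the set of natural numbers
-- with gap list Γ arises from the set with gap list G by shifting it by the number of
-- ascents of y and adjoining p whenever the p-th ascent (p = 0, 1, …) lies
-- inside a block.
data Flat {r : ℕ} : List (List (Fin r)) → List ℕ → List (Fin r) → List ℕ → Set where
  empty : ∀ {G} → Flat [] G [] G
  last  : ∀ {G x} → Flat ((x ∷ []) ∷ []) G (x ∷ []) G
  sep   : ∀ {G Γ x x′ b c y} → less x x′ ≡ false →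
          Flat ((x′ ∷ b) ∷ c) G (x′ ∷ y) Γ →
          Flat ((x ∷ []) ∷ (x′ ∷ b) ∷ c) G (x ∷ x′ ∷ y) Γ
  cut₀  : ∀ {G x x′ b c y} → less x x′ ≡ true →
          Flat ((x′ ∷ b) ∷ c) G (x′ ∷ y) [] →
          Flat ((x ∷ []) ∷ (x′ ∷ b) ∷ c) G (x ∷ x′ ∷ y) []
  cut₁  : ∀ {G g Γ x x′ b c y} → less x x′ ≡ true →
          Flat ((x′ ∷ b) ∷ c) G (x′ ∷ y) (g ∷ Γ) →
          Flat ((x ∷ []) ∷ (x′ ∷ b) ∷ c) G (x ∷ x′ ∷ y) (suc g ∷ Γ)
  join  : ∀ {G Γ x x′ b c y} → less x x′ ≡ true →
          Flat ((x′ ∷ b) ∷ c) G (x′ ∷ y) Γ →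
          Flat ((x ∷ x′ ∷ b) ∷ c) G (x ∷ x′ ∷ y) (0 ∷ Γ)

true≢false : ∀ {b} → b ≡ true → b ≡ false → ⊥
true≢false refl ()

flatten⁺ : ∀ {x : Fin r} {b c} G → All Ascending ((x ∷ b) ∷ c) →
          ∃ λ y → ∃ λ Γ → Flat ((x ∷ b) ∷ c) G (x ∷ y) Γ
flatten⁺ {b = []}     {[]} G _ = [] , G , last
flatten⁺ {x = x} {[]} {(x′ ∷ b) ∷ c} G (_ ∷ as) with less x x′ in eq | flatten⁺ G as
... | false | y , Γ , h     = _ , _ , sep eq h
... | true  | y , [] , h    = _ , _ , cut₀ eq h
... | true  | y , g ∷ Γ , h = _ , _ , cut₁ eq h
flatten⁺ {b = x′ ∷ b} G ((lt ∷ a) ∷ as) with flatten⁺ G (a ∷ as)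
... | y , Γ , h = _ , _ , join lt h
flatten⁺ {b = []} {[] ∷ c} G (_ ∷ () ∷ as)

-- The first ascent has number 0, so it is interior exactly when the set contains 0, that is, when
-- its gap list begins with 0. Otherwise the set is shifted down by one.
unflatten⁺ : ∀ (x : Fin r) y Γ → ∃ λ b → ∃ λ c → ∃ λ G → Flat ((x ∷ b) ∷ c) G (x ∷ y) Γ
unflatten⁺ x []       Γ = _ , _ , _ , last
unflatten⁺ x (x′ ∷ y) Γ with less x x′ in eq
unflatten⁺ x (x′ ∷ y) Γ | false with unflatten⁺ x′ y Γ
... | _ , _ , _ , h = _ , _ , _ , sep eq h
unflatten⁺ x (x′ ∷ y) [] | true with unflatten⁺ x′ y []
... | _ , _ , _ , h = _ , _ , _ , cut₀ eq h
unflatten⁺ x (x′ ∷ y) (zero ∷ Γ) | true with unflatten⁺ x′ y Γ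
... | _ , _ , _ , h = _ , _ , _ , join eq h
unflatten⁺ x (x′ ∷ y) (suc g ∷ Γ) | true with unflatten⁺ x′ y (g ∷ Γ)
... | _ , _ , _ , h = _ , _ , _ , cut₁ eq h

Flat-functional : ∀ {c : List (List (Fin r))} {G y Γ y′ Γ′} →
                  Flat c G y Γ → Flat c G y′ Γ′ → (y , Γ) ≡ (y′ , Γ′)
Flat-functional empty      empty       = refl
Flat-functional last       last        = refl
Flat-functional (sep _ h)  (sep _ k) with Flat-functional h k
... | refl = refl
Flat-functional (cut₀ _ h) (cut₀ _ k) with Flat-functional h k
... | refl = refl
-- The set obtained from the remaining blocks would be both empty and non-empty.
Flat-functional (cut₀ _ h) (cut₁ _ k) with Flat-functional h k
... | ()
Flat-functional (cut₁ _ h) (cut₀ _ k) with Flat-functional h k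
... | ()
Flat-functional (cut₁ _ h) (cut₁ _ k) with Flat-functional h k
... | refl = refl
Flat-functional (join _ h) (join _ k) with Flat-functional h k
... | refl = refl
Flat-functional (sep p h)  (cut₀ q k) = ⊥-elim (true≢false q p)
Flat-functional (sep p h)  (cut₁ q k) = ⊥-elim (true≢false q p)
Flat-functional (cut₀ q h) (sep p k)  = ⊥-elim (true≢false q p)
Flat-functional (cut₁ q h) (sep p k)  = ⊥-elim (true≢false q p)

-- The shape of `Γ` tells the constructors for an ascent apart: empty for `cut₀`, a successor in
-- front for `cut₁`, 0 in front for `join`.
Flat-injective : ∀ {c c′ : List (List (Fin r))} {G G′ y Γ} →
                 Flat c G y Γ → Flat c′ G′ y Γ → (c , G) ≡ (c′ , G′)
Flat-injective empty      empty       = refl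
Flat-injective last       last        = refl
Flat-injective (sep _ h)  (sep _ k) with Flat-injective h k
... | refl = refl
Flat-injective (cut₀ _ h) (cut₀ _ k) with Flat-injective h k
... | refl = refl
Flat-injective (cut₁ _ h) (cut₁ _ k) with Flat-injective h k
... | refl = refl
Flat-injective (join _ h) (join _ k) with Flat-injective h k
... | refl = refl
Flat-injective (sep p h)  (cut₀ q k) = ⊥-elim (true≢false q p)
Flat-injective (sep p h)  (cut₁ q k) = ⊥-elim (true≢false q p)
Flat-injective (sep p h)  (join q k) = ⊥-elim (true≢false q p)
Flat-injective (cut₀ q h) (sep p k)  = ⊥-elim (true≢false q p)
Flat-injective (cut₁ q h) (sep p k)  = ⊥-elim (true≢false q p)
Flat-injective (join q h) (sep p k)  = ⊥-elim (true≢false q p)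

Flat-ascending : ∀ {c : List (List (Fin r))} {G y Γ} → Flat c G y Γ → All Ascending c
Flat-ascending empty      = []
Flat-ascending last       = [-] ∷ []
Flat-ascending (sep _ h)  = [-] ∷ Flat-ascending h
Flat-ascending (cut₀ _ h) = [-] ∷ Flat-ascending h
Flat-ascending (cut₁ _ h) = [-] ∷ Flat-ascending h
Flat-ascending (join p h) with Flat-ascending h
... | a ∷ as = (p ∷ a) ∷ as

-- Each interior ascent saves one block and adds one element to the set.
Flat-length : ∀ {c : List (List (Fin r))} {G y Γ} → Flat c G y Γ →
              length y + length G ≡ length c + length Γ
Flat-length empty      = refl
Flat-length last       = refl
Flat-length (sep _ h)  = cong suc (Flat-length h)
Flat-length (cut₀ _ h) = cong suc (Flat-length h)
Flat-length (cut₁ _ h) = cong suc (Flat-length h)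
Flat-length {c = c} (join {Γ = Γ} _ h) =
  trans (cong suc (Flat-length h)) (sym (+-suc (length c) (length Γ)))

Flat-count : ∀ {c : List (List (Fin r))} {G y Γ} i → Flat c G y Γ → count i y ≡ blockCount i c
Flat-count i empty              = refl
Flat-count i (last {x = x})     = sym (+-identityʳ _)
Flat-count i (sep {x = x} _ h) with toℕ x ≡ᵇ toℕ i
... | true  = cong suc (Flat-count i h)
... | false = Flat-count i h
Flat-count i (cut₀ {x = x} _ h) with toℕ x ≡ᵇ toℕ i
... | true  = cong suc (Flat-count i h)
... | false = Flat-count i h
Flat-count i (cut₁ {x = x} _ h) with toℕ x ≡ᵇ toℕ i
... | true  = cong suc (Flat-count i h)
... | false = Flat-count i h
Flat-count i (join {x = x} _ h) with toℕ x ≡ᵇ toℕ i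
... | true  = cong suc (Flat-count i h)
... | false = Flat-count i h

-- The ascents inside the first block, the only ones that `adj blockGap` misses.
headExcess : List (List (Fin r)) → ℕ
headExcess []      = 0
headExcess (b ∷ _) = length b ∸ 1

adj-blockGap-∷ : ∀ (x x′ : Fin r) b c →
                 adj blockGap ((x ∷ x′ ∷ b) ∷ c) ≡ adj blockGap ((x′ ∷ b) ∷ c)
adj-blockGap-∷ x x′ b []      = refl
adj-blockGap-∷ x x′ b (_ ∷ _) = refl

adj-singleton : ∀ (x x′ : Fin r) b c {a} → a ≡ adj blockGap ((x′ ∷ b) ∷ c) + length b →
                asc x x′ + a ≡ adj blockGap ((x ∷ []) ∷ (x′ ∷ b) ∷ c) + 0
adj-singleton x x′ b c refl = lemma (asc x x′) (adj blockGap ((x′ ∷ b) ∷ c)) (length b)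
  where
  lemma : ∀ m n o → m + (n + o) ≡ o + m + n + 0
  lemma = solve-∀

Flat-adj : ∀ {c : List (List (Fin r))} {G y Γ} → Flat c G y Γ →
           adj asc y ≡ adj blockGap c + headExcess c
Flat-adj empty = refl
Flat-adj last  = refl
Flat-adj (sep  {b = b} {c} _ h) = adj-singleton _ _ b c (Flat-adj h)
Flat-adj (cut₀ {b = b} {c} _ h) = adj-singleton _ _ b c (Flat-adj h)
Flat-adj (cut₁ {b = b} {c} _ h) = adj-singleton _ _ b c (Flat-adj h)
Flat-adj (join {x = x} {x′} {b} {c} p h)
  rewrite p | Flat-adj h | adj-blockGap-∷ x x′ b c = sym (+-suc _ _)

Flat-adj-singleton : ∀ {c : List (List (Fin r))} {G y Γ x} → Flat ((x ∷ []) ∷ c) G y Γ →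
                     adj blockGap ((x ∷ []) ∷ c) ≡ adj asc y
Flat-adj-singleton h = sym (trans (Flat-adj h) (+-identityʳ _))

-- Let a be the number of ascents of `y`. `maj asc y` sums the ascents of all suffixes of `y`. Those
-- starting at the last letter of a block yield `maj blockGap c`; any other starts just before an
-- interior ascent, say number p, and contributes a - p. That ascent adjoins p to the set, while
-- each old element rises by a, so every element of the new set accounts for one a.
Flat-weight : ∀ {c : List (List (Fin r))} {G y Γ} → Flat c G y Γ →
              risingSum Γ + triangle (length Γ) + maj asc y
            ≡ risingSum G + triangle (length G) + maj blockGap c + adj asc y * length Γ
Flat-weight empty = sym (+-identityʳ _)
Flat-weight last  = sym (+-identityʳ _)
-- The first block is a single letter, so both major indices gain the same number of ascents.
Flat-weight {G = G} f@(sep {Γ = Γ} {b = b} {c} {y} p h)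
  rewrite Flat-adj-singleton f | p =
  step (risingSum Γ + triangle (length Γ)) (maj asc (_ ∷ y))
       (risingSum G + triangle (length G)) (maj blockGap ((_ ∷ b) ∷ c)) (adj asc (_ ∷ y)) (length Γ)
       (Flat-weight h)
  where
  step : ∀ s m t n a i → s + m ≡ t + n + a * i → s + (a + m) ≡ t + (a + n) + a * i
  step s m t n a i ih = trans (lemma₁ s a m) (trans (cong (a +_) ih) (lemma₂ t n a i))
    where
    lemma₁ : ∀ s a m → s + (a + m) ≡ a + (s + m)
    lemma₁ = solve-∀
    lemma₂ : ∀ t n a i → a + (t + n + a * i) ≡ t + (a + n) + a * i
    lemma₂ = solve-∀
Flat-weight {G = G} f@(cut₀ {b = b} {c} {y} p h)
  rewrite Flat-adj-singleton f | p =
  step (maj asc (_ ∷ y)) (risingSum G + triangle (length G)) (maj blockGap ((_ ∷ b) ∷ c))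
       (adj asc (_ ∷ y)) (Flat-weight h)
  where
  step : ∀ m t n a → m ≡ t + n + a * 0 → suc (a + m) ≡ t + (suc (a + n)) + a * 0
  step m t n a ih = trans (cong (λ k → suc (a + k)) ih) (lemma t n a)
    where
    lemma : ∀ t n a → suc (a + (t + n + a * 0)) ≡ t + (suc (a + n)) + a * 0
    lemma = solve-∀
Flat-weight {G = G} f@(cut₁ {g = g} {Γ} {b = b} {c} {y} p h)
  rewrite Flat-adj-singleton f | p =
  step (g * suc (length Γ)) (risingSum Γ) (triangle (suc (length Γ))) (maj asc (_ ∷ y))
       (risingSum G + triangle (length G)) (maj blockGap ((_ ∷ b) ∷ c))
       (adj asc (_ ∷ y)) (length Γ) (Flat-weight h)
  where
  step : ∀ e s u m t n a i → e + s + u + m ≡ t + n + a * suc i →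
         suc (i + e) + s + u + (suc a + m) ≡ t + (suc (a + n)) + suc a * suc i
  step e s u m t n a i ih =
    trans (lemma₁ e s u m a i) (trans (cong (suc (suc (a + i)) +_) ih) (lemma₂ t n a i))
    where
    lemma₁ : ∀ e s u m a i → suc (i + e) + s + u + (suc a + m) ≡ suc (suc (a + i)) + (e + s + u + m)
    lemma₁ = solve-∀
    lemma₂ : ∀ t n a i → suc (suc (a + i)) + (t + n + a * suc i) ≡ t + (suc (a + n)) + suc a * suc i
    lemma₂ = solve-∀
-- The letter extends the first block: `maj blockGap` is unchanged, while `maj asc` gains all
-- ascents of the word.
Flat-weight {G = G} (join {Γ = Γ} {x} {x′} {b} {c} {y} p h)
  rewrite adj-blockGap-∷ x x′ b c | p =
  step (risingSum Γ) (triangle (length Γ)) (maj asc (_ ∷ y))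
       (risingSum G + triangle (length G)) (maj blockGap ((_ ∷ b) ∷ c))
       (adj asc (_ ∷ y)) (length Γ) (Flat-weight h)
  where
  step : ∀ s u m t n a i → s + u + m ≡ t + n + a * i →
         s + (i + u) + (suc a + m) ≡ t + n + suc a * suc i
  step s u m t n a i ih = trans (lemma₁ s u m a i) (trans (cong (suc a + i +_) ih) (lemma₂ t n a i))
    where
    lemma₁ : ∀ s u m a i → s + (i + u) + (suc a + m) ≡ suc a + i + (s + u + m)
    lemma₁ = solve-∀
    lemma₂ : ∀ t n a i → suc a + i + (t + n + a * i) ≡ t + n + suc a * suc i
    lemma₂ = solve-∀

-- Words as pairs of gap lists: reversal and reconstruction

asc+nonDesc : ∀ (x y : Fin r) → asc x y + nonDesc y x ≡ 1
asc+nonDesc x y with less x y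
... | true  = refl
... | false = refl

-- Read backwards, `nonDesc` marks the non-ascents of the word, so in the reversed segment ascents
-- and non-ascents together make up its `length xs` adjacent pairs.
adj-ʳ++ : ∀ (x : Fin r) xs ys →
          adj asc (xs ʳ++ (x ∷ ys)) + adj nonDesc (x ∷ xs) ≡ length xs + adj asc (x ∷ ys)
adj-ʳ++ x []        ys = +-identityʳ _
adj-ʳ++ x (x′ ∷ xs) ys = begin
  u + (nonDesc x x′ + n)        ≡⟨ lemma₁ u (nonDesc x x′) n ⟩
  nonDesc x x′ + (u + n)        ≡⟨ cong (nonDesc x x′ +_) (adj-ʳ++ x′ xs (x ∷ ys)) ⟩
  nonDesc x x′ + (length xs + (asc x′ x + adj asc (x ∷ ys)))
                                ≡⟨ lemma₂ (nonDesc x x′) (length xs) (asc x′ x) _ ⟩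
  (asc x′ x + nonDesc x x′) + (length xs + adj asc (x ∷ ys))
                                ≡⟨ cong (_+ (length xs + adj asc (x ∷ ys))) (asc+nonDesc x′ x) ⟩
  suc (length xs) + adj asc (x ∷ ys) ∎
  where
  open ≡-Reasoning
  u = adj asc (xs ʳ++ (x′ ∷ x ∷ ys))
  n = adj nonDesc (x′ ∷ xs)
  lemma₁ : ∀ a b c → a + (b + c) ≡ b + (a + c)
  lemma₁ = solve-∀
  lemma₂ : ∀ a b c d → a + (b + (c + d)) ≡ c + a + (b + d)
  lemma₂ = solve-∀

-- The counterpart of `Flat-weight` for overpartitions, with the same product of a number of ascents
-- and a number of overlined parts. Moving a letter from `xs` to `ys` changes the two sides by
-- amounts that `adj-ʳ++` balances.
maj-ʳ++ : ∀ (xs ys : List (Fin r)) →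
          maj nonDesc xs + maj asc ys + adj asc (xs ʳ++ ys) * length xs
        ≡ triangle (length xs) + maj asc (xs ʳ++ ys)
maj-ʳ++ []       ys = lemma (maj asc ys) (adj asc ys)
  where
  lemma : ∀ m a → m + a * 0 ≡ m
  lemma = solve-∀
-- Adding `a` completes `maj asc ys` to `maj asc (x ∷ ys)`, as the induction hypothesis requires.
maj-ʳ++ (x ∷ xs) ys = +-cancelʳ-≡ a _ _ (begin
  (n + maj nonDesc xs) + maj asc ys + u * suc l + a
    ≡⟨ lemma₁ n (maj nonDesc xs) (maj asc ys) u l a ⟩
  (u + n) + (maj nonDesc xs + (a + maj asc ys) + u * l)
    ≡⟨ cong₂ _+_ (adj-ʳ++ x xs ys) (maj-ʳ++ xs (x ∷ ys)) ⟩
  (l + a) + (triangle l + maj asc (xs ʳ++ (x ∷ ys)))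
    ≡⟨ lemma₂ l a (triangle l) _ ⟩
  l + triangle l + maj asc (xs ʳ++ (x ∷ ys)) + a ∎)
  where
  open ≡-Reasoning
  u = adj asc (xs ʳ++ (x ∷ ys))
  n = adj nonDesc (x ∷ xs)
  l = length xs
  a = adj asc (x ∷ ys)
  lemma₁ : ∀ n m k u l a → (n + m) + k + u * suc l + a ≡ (u + n) + (m + (a + k) + u * l)
  lemma₁ = solve-∀
  lemma₂ : ∀ l a t m → (l + a) + (t + m) ≡ l + t + m + a
  lemma₂ = solve-∀

-- Inverse to `word`: the first letters of `y`, one for each gap in `Γ`, colour the overlined parts,
-- and the accumulator restores their decreasing order. The second clause is a default, excluded
-- when `y` has as many letters as there are gaps in `Γ` and `H`.
rebuild : List (ℕ × Fin r) → List ℕ → List (Fin r) → List ℕ → GapPair r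
rebuild as []      y       H = as , zip H y
rebuild as (_ ∷ _) []      H = as , []
rebuild as (g ∷ Γ) (x ∷ y) H = rebuild ((g , x) ∷ as) Γ y H

rebuild-gaps : ∀ (as bs : List (ℕ × Fin r)) Γ y H →
               rebuild bs (map proj₁ as ʳ++ Γ) (map proj₂ as ʳ++ y) H
             ≡ rebuild (as ++ bs) Γ y H
rebuild-gaps []       bs Γ y H = refl
rebuild-gaps ((g , x) ∷ as) bs Γ y H = rebuild-gaps as bs (g ∷ Γ) (x ∷ y) H

zip-map-proj : ∀ (bs : List (ℕ × C)) → zip (map proj₁ bs) (map proj₂ bs) ≡ bs
zip-map-proj []       = refl
zip-map-proj (b ∷ bs) = cong (b ∷_) (zip-map-proj bs)

word : GapPair r → List (Fin r)
word (as , bs) = map proj₂ as ʳ++ map proj₂ bs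

rebuild-word : ∀ (as bs : List (ℕ × Fin r)) →
               rebuild [] (reverse (map proj₁ as)) (word (as , bs)) (map proj₁ bs) ≡ (as , bs)
rebuild-word as bs = trans (rebuild-gaps as [] [] (map proj₂ bs) (map proj₁ bs))
                           (cong₂ _,_ (++-identityʳ as) (zip-map-proj bs))

proj₁-zip : ∀ (H : List ℕ) (y : List C) → length y ≡ length H → map proj₁ (zip H y) ≡ H
proj₁-zip []      []      _ = refl
proj₁-zip (h ∷ H) (x ∷ y) e = cong (h ∷_) (proj₁-zip H y (suc-injective e))

proj₂-zip : ∀ (H : List ℕ) (y : List C) → length y ≡ length H → map proj₂ (zip H y) ≡ y
proj₂-zip []      []      _ = refl
proj₂-zip (h ∷ H) (x ∷ y) e = cong (x ∷_) (proj₂-zip H y (suc-injective e))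

word-rebuild : ∀ (as : List (ℕ × Fin r)) Γ y H → length y ≡ length Γ + length H →
               let as′ , bs′ = rebuild as Γ y H in
               word (as′ , bs′) ≡ map proj₂ as ʳ++ y
             × reverse (map proj₁ as′) ≡ map proj₁ as ʳ++ Γ
             × map proj₁ bs′ ≡ H
word-rebuild as []      y       H e = cong (map proj₂ as ʳ++_) (proj₂-zip H y e) , refl , proj₁-zip H y e
word-rebuild as (g ∷ Γ) (x ∷ y) H e = word-rebuild ((g , x) ∷ as) Γ y H (suc-injective e)

module _ {Z : Set} (s : Z → Statistic 1 → ℕ) where

  withBlocks : List (List (Fin r)) × Z → Statistic r → ℕ
  withBlocks (c , z) (colour i)   = blockCount i c
  withBlocks (c , z) nonOverlined = s z nonOverlined
  withBlocks (c , z) total        = s z total + maj blockGap c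

  ValidBlocks : List (List (Fin r)) × Z → Set
  ValidBlocks (c , z) = All Ascending c × length c ≡ s z (colour zero)

module _ {W Z : Set} {s : W → Statistic 1 → ℕ} {t : Z → Statistic 1 → ℕ} where

  open Correspondence

  -- Blocks are carried along unchanged: they add `maj blockGap` to the total, and their number is
  -- tied to `colour zero`, which is preserved.
  addBlocks : Correspondence (λ _ → ⊤) (λ _ → ⊤) s t →
              Correspondence (ValidBlocks s {r}) (ValidBlocks t) (withBlocks s) (withBlocks t)
  addBlocks d = record
    { R          = λ (c , w) (c′ , z) → c ≡ c′ × R d w z × ValidBlocks s (c , w)
    ; sound      = λ { (refl , h , a , e) → (a , e) , a , trans e (stat d h (colour zero)) }
    ; image      = λ {(c , w)} v → let z , h = image d tt in (c , z) , refl , h , v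
    ; preimage   = λ {(c , z)} (a , e) → let w , h = preimage d tt in
                     (c , w) , refl , h , a , trans e (sym (stat d h (colour zero)))
    ; functional = λ { (refl , h , _) (refl , h′ , _) → cong (_ ,_) (functional d h h′) }
    ; injective  = λ { (refl , h , _) (refl , h′ , _) → cong (_ ,_) (injective d h h′) }
    ; stat       = stats
    }
    where
    stats : ∀ {x y} → proj₁ x ≡ proj₁ y × R d (proj₂ x) (proj₂ y) × ValidBlocks s x → ∀ i → withBlocks s x i ≡ withBlocks t y i
    stats (refl , h , _) (colour i)   = refl
    stats (refl , h , _) nonOverlined = stat d h nonOverlined
    stats (refl , h , _) total        = cong (_+ _) (stat d h total)

count-ʳ++ : ∀ i (xs ys : List (Fin r)) → count i (xs ʳ++ ys) ≡ count i xs + count i ys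
count-ʳ++ i []       ys = refl
count-ʳ++ i (x ∷ xs) ys with toℕ x ≡ᵇ toℕ i in eq
... | true  = trans (count-ʳ++ i xs (x ∷ ys)) (trans (cong (count i xs +_) (hit eq)) (+-suc _ _))
  where
  hit : (toℕ x ≡ᵇ toℕ i) ≡ true → count i (x ∷ ys) ≡ suc (count i ys)
  hit e rewrite e = refl
... | false = trans (count-ʳ++ i xs (x ∷ ys)) (cong (count i xs +_) (miss eq))
  where
  miss : (toℕ x ≡ᵇ toℕ i) ≡ false → count i (x ∷ ys) ≡ count i ys
  miss e rewrite e = refl

length-word : ∀ (as bs : List (ℕ × Fin r)) → length (word (as , bs)) ≡ length as + length bs
length-word as bs =
  trans (length-ʳ++ (map proj₂ as)) (cong₂ _+_ (length-map proj₂ as) (length-map proj₂ bs))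

flatten : ∀ {c : List (List (Fin r))} G → All Ascending c → ∃ λ y → ∃ λ Γ → Flat c G y Γ
flatten {c = []}          G _  = [] , G , empty
flatten {c = (x ∷ _) ∷ _} G as with flatten⁺ G as
... | y , Γ , h = x ∷ y , Γ , h
flatten {c = [] ∷ _} G (() ∷ _)

unflatten : ∀ (y : List (Fin r)) Γ → ∃ λ c → ∃ λ G → Flat c G y Γ
unflatten []      Γ = [] , Γ , empty
unflatten (x ∷ y) Γ with unflatten⁺ x y Γ
... | _ , _ , _ , h = _ , _ , h

FlatPair : List (List (Fin r)) × List ℕ × List ℕ → GapPair r → Set
FlatPair (c , G , H) (as , bs) =
  Flat c G (word (as , bs)) (reverse (map proj₁ as)) × H ≡ map proj₁ bs

-- `Flat` turns the blocks and the set `G` into a word and a set `Γ`; cutting the word after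
-- `length Γ` letters distributes the colours over the overlined and the non-overlined gaps.
blocks↔gapPairs : Correspondence (ValidBlocks statN {r}) (λ _ → ⊤) (withBlocks statN) statG
blocks↔gapPairs {r} = record
  { R          = FlatPair
  ; sound      = λ { {_} {as , bs} (h , e) → valid {as = as} {bs} h e , tt }
  ; image      = λ { {c , G , H} (a , e) → flat G H a e }
  ; preimage   = λ { {as , bs} _ →
      let c , G , h = unflatten (word (as , bs)) (reverse (map proj₁ as))
      in (c , G , map proj₁ bs) , h , refl }
  ; functional = λ { {_} {as , bs} {as′ , bs′} (h , refl) (h′ , e′) → func h h′ e′ }
  ; injective  = λ { (h , refl) (h′ , refl) → inj h h′ }
  ; stat       = λ { {_} {as , bs} (h , refl) → stats as bs h }
  }
  where
  valid : ∀ {c : List (List (Fin r))} {G H as bs} → Flat c G (word (as , bs)) (reverse (map proj₁ as)) →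
          H ≡ map proj₁ bs → ValidBlocks statN (c , G , H)
  valid {c} {G} {as = as} {bs} h refl = Flat-ascending h , sym (+-cancelʳ-≡ (length as) _ _ (begin
    length G + length (map proj₁ bs) + length as ≡⟨ cong (λ n → length G + n + length as) (length-map proj₁ bs) ⟩
    length G + length bs + length as             ≡⟨ lemma (length G) (length bs) (length as) ⟩
    length as + length bs + length G             ≡⟨ cong (_+ length G) (length-word as bs) ⟨
    length (word (as , bs)) + length G           ≡⟨ Flat-length h ⟩
    length c + length (reverse (map proj₁ as))   ≡⟨ cong (length c +_) (trans (length-reverse (map proj₁ as)) (length-map proj₁ as)) ⟩
    length c + length as                         ∎))
    where
    open ≡-Reasoning
    lemma : ∀ g b a → g + b + a ≡ a + b + g
    lemma = solve-∀

  flat : ∀ {c : List (List (Fin r))} G H → All Ascending c → length c ≡ length G + length H →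
         ∃ λ p → FlatPair (c , G , H) p
  flat {c} G H a e with flatten G a
  ... | y , Γ , h with rebuild [] Γ y H | word-rebuild [] Γ y H lengths
    where
    lengths : length y ≡ length Γ + length H
    lengths = +-cancelʳ-≡ (length G) _ _ (trans (Flat-length h) (trans (cong (_+ length Γ) e)
      (lemma (length G) (length H) (length Γ))))
      where
      lemma : ∀ g h γ → g + h + γ ≡ γ + h + g
      lemma = solve-∀
  ... | as , bs | refl , refl , refl = (as , bs) , h , refl

  func : ∀ {c : List (List (Fin r))} {G as bs as′ bs′} →
         Flat c G (word (as , bs)) (reverse (map proj₁ as)) →
         Flat c G (word (as′ , bs′)) (reverse (map proj₁ as′)) →
         map proj₁ bs ≡ map proj₁ bs′ → (as , bs) ≡ (as′ , bs′)
  func {as = as} {bs} {as′} {bs′} h h′ e =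
    trans (sym (rebuild-word as bs))
      (trans (cong₂ (λ (y , Γ) H → rebuild [] Γ y H) (Flat-functional h h′) e) (rebuild-word as′ bs′))

  inj : ∀ {c c′ : List (List (Fin r))} {G G′ y Γ H} →
        Flat c G y Γ → Flat c′ G′ y Γ → (c , G , H) ≡ (c′ , G′ , H)
  inj h h′ with Flat-injective h h′
  ... | refl = refl

  stats : ∀ {c : List (List (Fin r))} {G} as bs → Flat c G (word (as , bs)) (reverse (map proj₁ as)) →
          ∀ s → withBlocks statN (c , G , map proj₁ bs) s ≡ statG (as , bs) s
  stats as bs h (colour i)   = trans (sym (Flat-count i h)) (count-ʳ++ i (map proj₂ as) (map proj₂ bs))
  stats as bs h nonOverlined = length-map proj₁ bs
  -- Both `Flat-weight` and `maj-ʳ++` contain `u * l`, so it is added on both sides and cancelled.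
  stats {c} {G} as bs h total = +-cancelʳ-≡ (u * l) _ _ (begin
    p + q + w′ + m + u * l                  ≡⟨ lemma₁ (p + q) w′ m (u * l) ⟩
    w′ + (p + q + m + u * l)                ≡⟨ cong (λ n → w′ + (p + q + m + u * n)) lengths ⟨
    w′ + (p + q + m + u * length (reverse (map proj₁ as)))
                                            ≡⟨ cong (w′ +_) (Flat-weight h) ⟨
    w′ + (risingSum (reverse (map proj₁ as)) + triangle (length (reverse (map proj₁ as))) + maj asc (word (as , bs)))
      ≡⟨ cong₂ (λ a n → w′ + (a + triangle n + maj asc (word (as , bs)))) (risingSum-reverse (map proj₁ as)) lengths ⟩
    w′ + (t + triangle l + maj asc (word (as , bs)))
      ≡⟨ lemma₂ w′ t (triangle l) _ ⟩
    w′ + t + (triangle l + maj asc (word (as , bs)))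
      ≡⟨ cong (w′ + t +_) (maj-ʳ++ (map proj₂ as) (map proj₂ bs)) ⟨
    w′ + t + (maj nonDesc (map proj₂ as) + maj asc (map proj₂ bs) + u * l)
      ≡⟨ lemma₃ w′ t (maj nonDesc (map proj₂ as)) (maj asc (map proj₂ bs)) (u * l) ⟩
    (t + maj nonDesc (map proj₂ as)) + (w′ + maj asc (map proj₂ bs)) + u * l ∎)
    where
    open ≡-Reasoning
    u = adj asc (word (as , bs))
    l = length (map proj₂ as)
    p = risingSum G
    q = triangle (length G)
    m = maj blockGap c
    t = weightedSum (map proj₁ as)
    w′ = weightedSum (map proj₁ bs)
    lengths : length (reverse (map proj₁ as)) ≡ l
    lengths = trans (length-reverse (map proj₁ as)) (trans (length-map proj₁ as) (sym (length-map proj₂ as)))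
    lemma₁ : ∀ p w m x → p + w + m + x ≡ w + (p + m + x)
    lemma₁ = solve-∀
    lemma₂ : ∀ w t r m → w + (t + r + m) ≡ w + t + (r + m)
    lemma₂ = solve-∀
    lemma₃ : ∀ w t n a x → w + t + (n + a + x) ≡ (t + n) + (w + a) + x
    lemma₃ = solve-∀

-- Colours as blocks of primary colours

Increasing : List (Fin r) → Set
Increasing = Linked (λ x y → less x y ≡ true)

prefix : Bool → List (Fin r) → List (Fin (suc r))
prefix true  xs = zero ∷ map suc xs
prefix false xs = map suc xs

-- Uses the same halving as `bit`; `primaries-decode` identifies the result with `primaries`.
decode : ∀ r → ℕ → List (Fin r)
decode zero    i = []
decode (suc r) i = prefix (bit 0 i) (decode r (i / 2))

encode : List (Fin r) → ℕ
encode xs = sum (map (λ x → 2 ^ toℕ x) xs)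

filterᵇ-map : ∀ {A B : Set} (p : B → Bool) (f : A → B) xs →
              filterᵇ p (map f xs) ≡ map f (filterᵇ (p ∘ f) xs)
filterᵇ-map p f []       = refl
filterᵇ-map p f (x ∷ xs) with p (f x)
... | true  = cong (f x ∷_) (filterᵇ-map p f xs)
... | false = filterᵇ-map p f xs

filterᵇ-applyUpTo : ∀ r i → filterᵇ (λ j → bit j i) (applyUpTo suc r) ≡ map suc (primaries r (i / 2))
filterᵇ-applyUpTo r i = trans (cong (filterᵇ (λ j → bit j i)) (sym (map-upTo suc r)))
                              (filterᵇ-map (λ j → bit j i) suc (upTo r))

primaries-decode : ∀ r i → primaries r i ≡ map toℕ (decode r i)
primaries-decode zero    i = refl
primaries-decode (suc r) i with bit 0 i | rest
  where
  rest : filterᵇ (λ j → bit j i) (applyUpTo suc r) ≡ map toℕ (map suc (decode r (i / 2)))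
  rest = begin
    filterᵇ (λ j → bit j i) (applyUpTo suc r)  ≡⟨ filterᵇ-applyUpTo r i ⟩
    map suc (primaries r (i / 2))              ≡⟨ cong (map suc) (primaries-decode r (i / 2)) ⟩
    map suc (map toℕ (decode r (i / 2)))       ≡⟨ map-∘ (decode r (i / 2)) ⟨
    map (suc ∘ toℕ) (decode r (i / 2))         ≡⟨ map-∘ (decode r (i / 2)) ⟩
    map toℕ (map suc (decode r (i / 2)))       ∎
    where open ≡-Reasoning
... | true  | eq = cong (0 ∷_) eq
... | false | eq = eq

encode-suc : ∀ (xs : List (Fin r)) → encode (map suc xs) ≡ encode xs * 2
encode-suc []       = refl
encode-suc (x ∷ xs) = trans (cong₂ _+_ (*-comm 2 (2 ^ toℕ x)) (encode-suc xs))
                            (sym (*-distribʳ-+ 2 (2 ^ toℕ x) (encode xs)))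

encode-prefix : ∀ b (xs : List (Fin r)) → encode (prefix b xs) ≡ χ b + encode xs * 2
encode-prefix true  xs = cong suc (encode-suc xs)
encode-prefix false xs = encode-suc xs

bit₀-double : ∀ b n → bit 0 (χ b + n * 2) ≡ b
bit₀-double b n = trans (cong (_≡ᵇ 1) ([m+kn]%n≡m%n (χ b) n 2)) (χ%2 b)
  where
  χ%2 : ∀ b → (χ b % 2 ≡ᵇ 1) ≡ b
  χ%2 true  = refl
  χ%2 false = refl

half-double : ∀ b n → (χ b + n * 2) / 2 ≡ n
half-double b n = trans (+-distrib-/-∣ʳ (χ b) (n∣m*n n)) (trans (cong (_+ n * 2 / 2) (χ/2 b)) (m*n/n≡m n 2))
  where
  χ/2 : ∀ b → χ b / 2 ≡ 0
  χ/2 true  = refl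
  χ/2 false = refl

χ-bit₀ : ∀ n → χ (bit 0 n) ≡ n % 2
χ-bit₀ n with n % 2 | m%n<n n 2
... | 0 | _ = refl
... | 1 | _ = refl
... | suc (suc _) | s≤s (s≤s ())

encode-decode : ∀ r {i} → i < 2 ^ r → encode (decode r i) ≡ i
encode-decode zero    {zero} _ = refl
encode-decode zero    {suc _} (s≤s ())
encode-decode (suc r) {i} lt = begin
  encode (prefix (bit 0 i) (decode r (i / 2)))   ≡⟨ encode-prefix (bit 0 i) (decode r (i / 2)) ⟩
  χ (bit 0 i) + encode (decode r (i / 2)) * 2    ≡⟨ cong₂ (λ a b → a + b * 2) (χ-bit₀ i)
                                                     (encode-decode r (m<n*o⇒m/o<n (subst (i <_) (*-comm 2 (2 ^ r)) lt))) ⟩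
  i % 2 + (i / 2) * 2                            ≡⟨ m≡m%n+[m/n]*n i 2 ⟨
  i                                              ∎
  where open ≡-Reasoning

-- No colour lies below `zero`, so `zero` can occur only in front.
all-suc : ∀ {x : Fin (suc r)} {xs} → Increasing (x ∷ xs) → ∃ λ ys → xs ≡ map suc ys
all-suc [-] = [] , refl
all-suc {x = x} {zero ∷ _} (p ∷ _) with x
... | zero  = ⊥-elim (true≢false p refl)
... | suc _ = ⊥-elim (true≢false p refl)
all-suc {xs = suc y ∷ _} (_ ∷ ps) with all-suc ps
... | ys , refl = y ∷ ys , refl

unprefix : ∀ {xs : List (Fin (suc r))} → Increasing xs →
           ∃ λ b → ∃ λ ys → xs ≡ prefix b ys × Increasing ys
unprefix {xs = []}         [] = false , [] , refl , []
unprefix {xs = zero ∷ _}   ps with all-suc ps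
... | ys , refl = true , ys , refl , map⁻ (Linked.tail ps)
unprefix {xs = suc x ∷ _}  ps with all-suc ps
... | ys , refl = false , x ∷ ys , refl , map⁻ ps

decode-encode : ∀ {xs : List (Fin r)} → Increasing xs → decode r (encode xs) ≡ xs
decode-encode {zero}  {[]} _  = refl
decode-encode {suc r} ps with unprefix ps
... | b , ys , refl , qs rewrite encode-prefix b ys | bit₀-double b (encode ys) | half-double b (encode ys) =
  cong (prefix b) (decode-encode qs)

encode<2^r : ∀ {xs : List (Fin r)} → Increasing xs → encode xs < 2 ^ r
encode<2^r {zero}  {[]} _ = s≤s z≤n
encode<2^r {suc r} ps with unprefix ps
... | b , ys , refl , qs rewrite encode-prefix b ys = begin
  suc (χ b + encode ys * 2)  ≤⟨ s≤s (+-monoˡ-≤ (encode ys * 2) (χ≤1 b)) ⟩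
  suc (encode ys) * 2        ≤⟨ *-monoˡ-≤ 2 (encode<2^r qs) ⟩
  2 ^ r * 2                  ≡⟨ *-comm (2 ^ r) 2 ⟩
  2 ^ suc r                  ∎
  where open ≤-Reasoning

Increasing-decode : ∀ r i → Increasing (decode r i)
Increasing-decode zero    i = []
Increasing-decode (suc r) i with bit 0 i | map⁺ {f = suc} (Increasing-decode r (i / 2))
... | false | ps = ps
... | true  | ps with decode r (i / 2)
...   | []    = [-]
...   | _ ∷ _ = refl ∷ ps

count-zero-suc : ∀ (xs : List (Fin r)) → count zero (map suc xs) ≡ 0
count-zero-suc []       = refl
count-zero-suc (x ∷ xs) = count-zero-suc xs

count-suc-suc : ∀ i (xs : List (Fin r)) → count (suc i) (map suc xs) ≡ count i xs
count-suc-suc i []       = refl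
count-suc-suc i (x ∷ xs) with toℕ x ≡ᵇ toℕ i
... | true  = cong suc (count-suc-suc i xs)
... | false = count-suc-suc i xs

count-decode : ∀ (i : Fin r) n → count i (decode r n) ≡ χ (bit (toℕ i) n)
count-decode {suc r} zero n with bit 0 n
... | true  = cong suc (count-zero-suc (decode r (n / 2)))
... | false = count-zero-suc (decode r (n / 2))
count-decode {suc r} (suc i) n with bit 0 n
... | true  = trans (count-suc-suc i (decode r (n / 2))) (count-decode i (n / 2))
... | false = trans (count-suc-suc i (decode r (n / 2))) (count-decode i (n / 2))

Ascending⇒Increasing : ∀ {xs : List (Fin r)} → Ascending xs → Increasing xs
Ascending⇒Increasing {xs = _ ∷ _} ps = ps

-- Positivity rules out the empty block, whose code is 0.
Ascending-decode : ∀ {i} → 1 ≤ i → i < 2 ^ r → Ascending (decode r i)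
Ascending-decode {r} {i} pos lt with decode r i | Increasing-decode r i | encode-decode r lt
... | []    | _  | refl = 1+n≰n pos
... | _ ∷ _ | ps | _    = ps

1≤encode : ∀ {xs : List (Fin r)} → Ascending xs → 1 ≤ encode xs
1≤encode {xs = x ∷ _} _ = ≤-trans (m^n>0 2 (toℕ x)) (m≤m+n _ _)

joint-δ : ∀ {xs ys : List (Fin r)} → Ascending xs → Ascending ys →
          joint xs ys ≡ (if lastOr0 (map toℕ xs) <ᵇ firstOr0 (map toℕ ys) then 1 else 0)
joint-δ {xs = x ∷ []} {y ∷ _} _ _ with toℕ x <ᵇ toℕ y
... | true  = refl
... | false = refl
joint-δ {xs = _ ∷ x ∷ xs} (_ ∷ p) q = joint-δ p q

-- The coloured sequences of the second kind

BlockPart : ℕ → Set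
BlockPart r = ℕ × (List (Fin r) × Bool)

block : BlockPart r → List (Fin r)
block (_ , b , _) = b

flag : BlockPart r → ℕ × Bool
flag (g , _ , o) = g , o

partGap : List (Fin r) × Bool → List (Fin r) × Bool → ℕ
partGap (b , o) (b′ , o′) = blockGap b b′ + χGap o o′

toBlockPart : ∀ r → EPart → BlockPart r
toBlockPart r (m , i , o) = m , decode r i , o

toEPart : BlockPart r → EPart
toEPart (m , b , o) = m , encode b , o

w-decode : ∀ r {j} → Ascending (decode r j) → w r j ≡ suc (length (decode r j) ∸ 1)
w-decode r {j} p rewrite primaries-decode r j | length-map toℕ (decode r j) with decode r j | p
... | _ ∷ _ | _ = refl

δ-decode : ∀ r {i j} → Ascending (decode r i) → Ascending (decode r j) →
           δ r i j ≡ joint (decode r i) (decode r j)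
δ-decode r {i} {j} p q rewrite primaries-decode r i | primaries-decode r j =
  sym (joint-δ {xs = decode r i} {decode r j} p q)

-- The final 1 compensates for `length b′ ∸ 1` in `blockGap`; the subtraction is exact because
-- blocks are non-empty.
EStep-gap : ∀ r {i j} b o o′ → Ascending (decode r i) → Ascending (decode r j) →
            b + w r j + χ o′ + δ r i j ≡ b + partGap (decode r i , o) (decode r j , o′) + 1
EStep-gap r {i} {j} b o o′ p q =
  trans (cong₂ (λ m n → b + m + χ o′ + n) (w-decode r {j} q) (δ-decode r {i} {j} p q))
        (lemma b (length (decode r j) ∸ 1) (joint (decode r i) (decode r j)) (χ o′))
  where
  lemma : ∀ b l j c → b + suc l + c + j ≡ b + (l + j + c) + 1
  lemma = solve-∀

EStep⇒Gapped : ∀ {p q} → ValidCol r p → ValidCol r q → EStep r p q →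
               Gapped partGap (toBlockPart r p) (toBlockPart r q)
EStep⇒Gapped {r} {a , i , o} {b , j , o′} (p , p′) (q , q′) (_ , h) =
  +-cancelʳ-≤ 1 _ _ (≤-trans (≤-reflexive (sym
    (EStep-gap r {i} {j} b o o′ (Ascending-decode p p′) (Ascending-decode q q′)))) h)

toBlockPart-toEPart : ∀ (p : BlockPart r) → Ascending (block p) → toBlockPart r (toEPart p) ≡ p
toBlockPart-toEPart (m , b , o) a = cong (λ b → m , b , o) (decode-encode (Ascending⇒Increasing {xs = b} a))

toEPart-toBlockPart : ∀ p → ValidCol r p → toEPart (toBlockPart r p) ≡ p
toEPart-toBlockPart {r} (m , i , o) (_ , lt) = cong (λ i → m , i , o) (encode-decode r lt)

ValidCol-toEPart : ∀ {p : BlockPart r} → Ascending (block p) → ValidCol r (toEPart p)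
ValidCol-toEPart {p = _ , b , _} a = 1≤encode {xs = b} a , encode<2^r (Ascending⇒Increasing {xs = b} a)

Gapped⇒EStep : ∀ {p q : BlockPart r} → Ascending (block p) → Ascending (block q) →
               Gapped partGap p q → EStep r (toEPart p) (toEPart q)
Gapped⇒EStep {r} {p@(a , xs , o)} {q@(b , ys , o′)} u v h =
  m+n≤o⇒m≤o b h , ≤-trans (≤-reflexive eq) (+-monoˡ-≤ 1 h)
  where
  xs≡ : decode r (encode xs) ≡ xs
  xs≡ = decode-encode (Ascending⇒Increasing {xs = xs} u)
  ys≡ : decode r (encode ys) ≡ ys
  ys≡ = decode-encode (Ascending⇒Increasing {xs = ys} v)
  eq : b + w r (encode ys) + χ o′ + δ r (encode xs) (encode ys) ≡ b + partGap (xs , o) (ys , o′) + 1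
  eq = trans (EStep-gap r {encode xs} {encode ys} b o o′
               (subst Ascending (sym xs≡) u) (subst Ascending (sym ys≡) v))
             (cong₂ (λ x y → b + partGap (x , o) (y , o′) + 1) xs≡ ys≡)

Linked-map-local : ∀ {A B : Set} {P : A → Set} {R : A → A → Set} {S : B → B → Set} {f : A → B} →
                   (∀ {x y} → P x → P y → R x y → S (f x) (f y)) →
                   ∀ {xs} → All P xs → Linked R xs → Linked S (map f xs)
Linked-map-local h []           []       = []
Linked-map-local h (_ ∷ [])     [-]      = [-]
Linked-map-local h (p ∷ q ∷ ps) (x ∷ xs) = h p q x ∷ Linked-map-local h (q ∷ ps) xs

AscendingParts : List (BlockPart r) → Set
AscendingParts = All (Ascending ∘ block)

statB : List (BlockPart r) → Statistic r → ℕ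
statB ps (colour i)   = blockCount i (map block ps)
statB ps nonOverlined = countᵇ (not ∘ proj₂) (map flag ps)
statB ps total        = weightedSum (map proj₁ ps) + maj partGap (map proj₂ ps)

statE : List EPart → Statistic r → ℕ
statE xs (colour i)   = countᵇ (hasPrimary (toℕ i)) xs
statE xs nonOverlined = countᵇ nonOverᵉ xs
statE xs total        = sum (map eval xs)

ValidE : ∀ r → List EPart → Set
ValidE r xs = All (ValidCol r) xs × Linked (EStep r) xs

map-local-id : ∀ {A : Set} {P : A → Set} {f : A → A} → (∀ x → P x → f x ≡ x) →
               ∀ {xs} → All P xs → map f xs ≡ xs
map-local-id h {xs} ps = trans (map-cong-local (All.map (λ {x} → h x) ps)) (map-id xs)

blockParts↔E : Correspondence AscendingParts (ValidE r) statB statE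
blockParts↔E {r} = fromInverses
  (map toEPart ∘ ungap partGap) (gap partGap ∘ map (toBlockPart r))
  (λ {ps} a → All-map⁺ (All.map (λ {p} → ValidCol-toEPart {p = p}) (ungapped a))
            , Linked-map-local (λ {p} {q} → Gapped⇒EStep {p = p} {q}) (ungapped a) (Linked-ungap partGap ps))
  (λ (v , _) → gapped (All-map⁺ (All.map (λ (p , q) → Ascending-decode p q) v)))
  (λ {ps} a → trans (cong (gap partGap) (trans (sym (map-∘ (ungap partGap ps)))
                                               (map-local-id toBlockPart-toEPart (ungapped a))))
                    (gap-ungap partGap ps))
  (λ {xs} (v , l) → trans (cong (map toEPart) (ungap-gap partGap (Linked-map-local (λ {p} {q} → EStep⇒Gapped {r} {p} {q}) v l)))
                          (trans (sym (map-∘ xs)) (map-local-id (toEPart-toBlockPart {r}) v)))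
  (λ a → stats a)
  where
  ungapped : ∀ {ps : List (BlockPart r)} → AscendingParts ps → AscendingParts (ungap partGap ps)
  ungapped []       = []
  ungapped (a ∷ as) = a ∷ ungapped as

  gapped : ∀ {ps : List (BlockPart r)} → AscendingParts ps → AscendingParts (gap partGap ps)
  gapped []       = []
  gapped (a ∷ as) = a ∷ gapped as

  stats : ∀ {ps : List (BlockPart r)} → AscendingParts ps →
          ∀ s → statB ps s ≡ statE (map toEPart (ungap partGap ps)) s
  stats [] (colour i) = refl
  -- A block contains a colour at most once, so `count-decode` expresses its multiplicity by one
  -- bit.
  stats {(_ , b , _) ∷ ps} (a ∷ as) (colour i)
    with bit (toℕ i) (encode b) | count-decode i (encode b)
  ... | true  | e rewrite decode-encode (Ascending⇒Increasing {xs = b} a) | e = cong suc (stats as (colour i))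
  ... | false | e rewrite decode-encode (Ascending⇒Increasing {xs = b} a) | e = stats as (colour i)
  stats [] nonOverlined = refl
  stats {(_ , _ , true)  ∷ _} (_ ∷ as) nonOverlined = stats as nonOverlined
  stats {(_ , _ , false) ∷ _} (_ ∷ as) nonOverlined = cong suc (stats as nonOverlined)
  stats {ps} _ total = sym (trans (cong sum (sym (map-∘ (ungap partGap ps)))) (sum-ungap partGap ps))

zipParts : List (List (Fin r)) → List (ℕ × Bool) → List (BlockPart r)
zipParts = zipWith (λ b (g , o) → g , b , o)

-- `partGap` is a term in the blocks plus a term in the flags, so `maj partGap` splits and the
-- blocks separate from the flagged gaps.
blockParts↔blocks : Correspondence AscendingParts (ValidBlocks statP {r}) statB (withBlocks statP)
blockParts↔blocks {r} = fromInverses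
  (λ ps → map block ps , map flag ps) (λ (c , fs) → zipParts c fs)
  (λ {ps} a → All-map⁺ a , trans (length-map block ps) (sym (length-map flag ps)))
  (λ (a , e) → zipped a e)
  (λ {ps} _ → zip-unzip-parts ps)
  (λ {(c , fs)} (_ , e) → cong₂ _,_ (blocks c fs e) (flags c fs e))
  (λ {ps} _ → stats ps)
  where
  zipped : ∀ {c : List (List (Fin r))} {fs : List (ℕ × Bool)} → All Ascending c → length c ≡ length fs →
           AscendingParts (zipParts c fs)
  zipped {fs = []}    []       _ = []
  zipped {fs = _ ∷ _} (a ∷ as) e = a ∷ zipped as (suc-injective e)

  zip-unzip-parts : ∀ (ps : List (BlockPart r)) → zipParts (map block ps) (map flag ps) ≡ ps
  zip-unzip-parts []       = refl
  zip-unzip-parts (p ∷ ps) = cong (p ∷_) (zip-unzip-parts ps)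

  blocks : ∀ (c : List (List (Fin r))) fs → length c ≡ length fs → map block (zipParts c fs) ≡ c
  blocks []      []       _ = refl
  blocks (b ∷ c) (_ ∷ fs) e = cong (b ∷_) (blocks c fs (suc-injective e))

  flags : ∀ (c : List (List (Fin r))) fs → length c ≡ length fs → map flag (zipParts c fs) ≡ fs
  flags []      []       _ = refl
  flags (b ∷ c) (f ∷ fs) e = cong (f ∷_) (flags c fs (suc-injective e))

  swap : ∀ a b c d → (a + b) + (c + d) ≡ (a + c) + (b + d)
  swap = solve-∀

  adj-partGap : ∀ (ps : List (BlockPart r)) →
                adj partGap (map proj₂ ps) ≡ adj blockGap (map block ps) + adj χGap (map proj₂ (map flag ps))
  adj-partGap []           = refl
  adj-partGap (_ ∷ [])     = refl
  adj-partGap ((_ , b , o) ∷ ps@((_ , b′ , o′) ∷ _)) =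
    trans (cong (partGap (b , o) (b′ , o′) +_) (adj-partGap ps)) (swap (blockGap b b′) (χ o′) _ _)

  maj-partGap : ∀ (ps : List (BlockPart r)) →
                maj partGap (map proj₂ ps) ≡ maj blockGap (map block ps) + maj χGap (map proj₂ (map flag ps))
  maj-partGap []       = refl
  maj-partGap (p ∷ ps) =
    trans (cong₂ _+_ (adj-partGap (p ∷ ps)) (maj-partGap ps)) (swap (adj blockGap (map block (p ∷ ps))) _ _ _)

  stats : ∀ (ps : List (BlockPart r)) s → statB ps s ≡ withBlocks statP (map block ps , map flag ps) s
  stats ps (colour i)   = refl
  stats ps nonOverlined = refl
  stats ps total = trans (cong₂ _+_ (cong weightedSum (map-∘ {g = proj₁} {flag} ps)) (maj-partGap ps))
                         (lemma (weightedSum (map proj₁ (map flag ps))) (maj blockGap (map block ps)) _)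
    where
    lemma : ∀ a b c → a + (b + c) ≡ a + c + b
    lemma = solve-∀

-- Assembly and passage to bijections

overpartitions↔E : Correspondence (Linked (DStep {r})) (ValidE r) statD statE
overpartitions↔E =
  flip gapPairs↔overpartitions ⨾ flip blocks↔gapPairs ⨾ flip (addBlocks flags↔uncoloured)
    ⨾ flip blockParts↔blocks ⨾ blockParts↔E

-- The four alternatives exclude one another, so the list of parts alone determines an element of
-- `Dbar`.
DStep-irrelevant : ∀ {p q : DPart r} → Irrelevant (DStep p q)
DStep-irrelevant (inj₁ a) (inj₁ b) = cong inj₁ (<-irrelevant a b)
DStep-irrelevant (inj₁ a) (inj₂ (inj₁ (refl , _)))        = ⊥-elim (<-irrefl refl a)
DStep-irrelevant (inj₁ a) (inj₂ (inj₂ (inj₁ (refl , _)))) = ⊥-elim (<-irrefl refl a)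
DStep-irrelevant (inj₁ a) (inj₂ (inj₂ (inj₂ (refl , _)))) = ⊥-elim (<-irrefl refl a)
DStep-irrelevant (inj₂ (inj₁ (refl , _)))        (inj₁ b) = ⊥-elim (<-irrefl refl b)
DStep-irrelevant (inj₂ (inj₂ (inj₁ (refl , _)))) (inj₁ b) = ⊥-elim (<-irrefl refl b)
DStep-irrelevant (inj₂ (inj₂ (inj₂ (refl , _)))) (inj₁ b) = ⊥-elim (<-irrefl refl b)
DStep-irrelevant (inj₂ (inj₁ (refl , a))) (inj₂ (inj₁ (refl , b))) =
  cong (λ p → inj₂ (inj₁ (refl , p))) (<-irrelevant a b)
DStep-irrelevant (inj₂ (inj₁ (_ , a))) (inj₂ (inj₂ (inj₁ (_ , refl , _)))) = ⊥-elim (<-irrefl refl a)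
DStep-irrelevant (inj₂ (inj₁ (_ , a))) (inj₂ (inj₂ (inj₂ (_ , refl , _)))) = ⊥-elim (<-irrefl refl a)
DStep-irrelevant (inj₂ (inj₂ (inj₁ (_ , refl , _)))) (inj₂ (inj₁ (_ , b))) = ⊥-elim (<-irrefl refl b)
DStep-irrelevant (inj₂ (inj₂ (inj₂ (_ , refl , _)))) (inj₂ (inj₁ (_ , b))) = ⊥-elim (<-irrefl refl b)
DStep-irrelevant (inj₂ (inj₂ (inj₁ (refl , refl , refl , refl)))) (inj₂ (inj₂ (inj₁ (refl , refl , refl , refl)))) = refl
DStep-irrelevant (inj₂ (inj₂ (inj₂ (refl , refl , refl , refl)))) (inj₂ (inj₂ (inj₂ (refl , refl , refl , refl)))) = refl
DStep-irrelevant (inj₂ (inj₂ (inj₁ (_ , _ , refl , _)))) (inj₂ (inj₂ (inj₂ (_ , _ , () , _))))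
DStep-irrelevant (inj₂ (inj₂ (inj₂ (_ , _ , refl , _)))) (inj₂ (inj₂ (inj₁ (_ , _ , () , _))))

×-irrelevant : ∀ {A B : Set} → Irrelevant A → Irrelevant B → Irrelevant (A × B)
×-irrelevant f g (a , b) (a′ , b′) = cong₂ _,_ (f a a′) (g b b′)

Stats : (X → Statistic r → ℕ) → Vec ℕ r → ℕ → ℕ → X → Set
Stats s ℓ k n x = s x total ≡ n × tabulate (λ i → s x (colour i)) ≡ ℓ × s x nonOverlined ≡ k

Stats-irrelevant : ∀ {s : X → Statistic r → ℕ} {ℓ k n x} → Irrelevant (Stats s ℓ k n x)
Stats-irrelevant = ×-irrelevant ≡-irrelevant (×-irrelevant ≡-irrelevant ≡-irrelevant)

module _ {P : X → Set} {Q : Y → Set} {s : X → Statistic r → ℕ} {t : Y → Statistic r → ℕ}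
         (P-irr : ∀ {x} → Irrelevant (P x)) (Q-irr : ∀ {y} → Irrelevant (Q y))
         (c : Correspondence P Q s t) (ℓ : Vec ℕ r) (k n : ℕ) where

  open Correspondence c

  private
    transport : ∀ {x y} → R x y → Stats s ℓ k n x → Stats t ℓ k n y
    transport h (a , b , d) =
      trans (sym (stat h total)) a ,
      trans (sym (tabulate-cong (λ i → stat h (colour i)))) b ,
      trans (sym (stat h nonOverlined)) d

    transport⁻ : ∀ {x y} → R x y → Stats t ℓ k n y → Stats s ℓ k n x
    transport⁻ h (a , b , d) =
      trans (stat h total) a ,
      trans (tabulate-cong (λ i → stat h (colour i))) b ,
      trans (stat h nonOverlined) d

    Fiberˡ Fiberʳ : Set
    Fiberˡ = Σ X λ x → P x × Stats s ℓ k n x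
    Fiberʳ = Σ Y λ y → Q y × Stats t ℓ k n y

    to : Fiberˡ → Fiberʳ
    to (x , p , e) = let y , h = image p in y , proj₂ (sound h) , transport h e

    from : Fiberʳ → Fiberˡ
    from (y , q , e) = let x , h = preimage q in x , proj₁ (sound h) , transport⁻ h e

    ≡ˡ : ∀ {u v : Fiberˡ} → proj₁ u ≡ proj₁ v → u ≡ v
    ≡ˡ {x , _} refl = cong (x ,_) (×-irrelevant P-irr (Stats-irrelevant {s = s} {x = x}) _ _)

    ≡ʳ : ∀ {u v : Fiberʳ} → proj₁ u ≡ proj₁ v → u ≡ v
    ≡ʳ {y , _} refl = cong (y ,_) (×-irrelevant Q-irr (Stats-irrelevant {s = t} {x = y}) _ _)

  -- Since all side conditions are proof-irrelevant, the inverse laws need checking on the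
  -- underlying objects only, where they are `functional` and `injective`.
  fibers↔ : Fiberˡ ↔ Fiberʳ
  fibers↔ = mk↔ₛ′ to from
    (λ (y , q , _) → let x , h = preimage q in ≡ʳ (functional (proj₂ (image (proj₁ (sound h)))) h))
    (λ (x , p , _) → let y , h = image p in ≡ˡ (injective (proj₂ (preimage (proj₂ (sound h)))) h))

theorem1p10 : (r : ℕ) → 1 ≤ r → (ℓ : Vec ℕ r) (k n : ℕ) →
    Dbar r ℓ k n ↔ Ebar r ℓ k n
theorem1p10 r _ ℓ k n =
  ↔-trans (fibers↔ (Linked.irrelevant DStep-irrelevant)
                   (×-irrelevant (All.irrelevant (×-irrelevant ≤-irrelevant ≤-irrelevant))
                                 (Linked.irrelevant (×-irrelevant ≤-irrelevant ≤-irrelevant)))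
                   overpartitions↔E ℓ k n)
          -- Re-brackets the two conditions paired in `ValidE`.
          (mk↔ₛ′ (λ (xs , (v , l) , e) → xs , v , l , e) (λ (xs , v , l , e) → xs , (v , l) , e)
                 (λ _ → refl) (λ _ → refl))
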